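{- Let $G$ be a connected graph of order $n\geq 3$. Then $sdiam_3(G)=n-1$ if and only if $G$ is isomorphic to $T_{a,b,c}$ for some integers $0\leq a\leq b\leq c$ with $1\leq b$ and $a+b+c=n-1$, or $G$ is isomorphic to $\triangle_{p,q,r}$ for some integers $0\leq p\leq q\leq r$ with $p+q+r=n-3$.
   Context: All graphs are finite, simple and undirected. For $S\subseteq V(G)$ with $|S|\geq 2$, the Steiner distance $d_G(S)$ is the minimum number of edges of a tree in $G$ whose vertex set contains $S$, and $sdiam_k(G)$ is the maximum of $d_G(S)$ over all $S\subseteq V(G)$ with $|S|=k$. $T_{a,b,c}$ denotes the tree of order $a+b+c+1$ with a vertex $v$ such that $T_{a,b,c}-v$ is the disjoint union of paths $P_a,P_b,P_c$ (with $a,b,c$ vertices respectively), $v$ being adjacent to one endvertex of each nonempty path; $T_{0,b,c}$ is a path. $\triangle_{p,q,r}$ denotes the unicyclic graph of order $p+q+r+3$ consisting of a triangle $K_3$ together with paths $P_p,P_q,P_r$ (with $p,q,r$ vertices) such that removing the triangle's vertices leaves $P_p\cup P_q\cup P_r$, each nonempty path being joined by an edge from one of its endvertices to a distinct vertex of the triangle. -}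

module Defs where

open import Data.Nat using (ℕ; zero; suc; _+_; _≤_; _≡ᵇ_; _<ᵇ_)
open import Data.Bool using (Bool; true; false; _∧_; _∨_; not)
open import Data.Bool.Properties using (∨-comm)
open import Data.Fin using (Fin; toℕ)
open import Data.Fin.Subset using (Subset; _∈_; _⊆_; ∣_∣)
open import Data.List using (List; []; _∷_; _++_; [_]; length; map; allFin)
open import Data.Nat.ListAction using (sum)
open import Data.List.Relation.Unary.Unique.Propositional using (Unique)
open import Data.Product using (Σ; _×_; _,_)
open import Data.Unit using (⊤)
open import Function.Bundles using (_↔_; Inverse)
open import Relation.Binary.PropositionalEquality using (_≡_; refl; cong₂)

record Graph (n : ℕ) : Set where
  field
    adj    : Fin n → Fin n → Bool
    sym    : ∀ i j → adj i j ≡ adj j i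
    irrefl : ∀ i → adj i i ≡ false
open Graph public

eqb-refl : ∀ x → (x ≡ᵇ x) ≡ true
eqb-refl zero    = refl
eqb-refl (suc x) = eqb-refl x

eqb-sym : ∀ x y → (x ≡ᵇ y) ≡ (y ≡ᵇ x)
eqb-sym zero    zero    = refl
eqb-sym zero    (suc y) = refl
eqb-sym (suc x) zero    = refl
eqb-sym (suc x) (suc y) = eqb-sym x y

_==_ : ∀ {n} → Fin n → Fin n → Bool
i == j = toℕ i ≡ᵇ toℕ j

fromRel : ∀ {n} → (Fin n → Fin n → Bool) → Graph n
fromRel {n} r = record { adj = a ; sym = s ; irrefl = ir }
  where
  a : Fin n → Fin n → Bool
  a i j = (r i j ∨ r j i) ∧ not (i == j)
  eqsym : ∀ (i j : Fin n) → (i == j) ≡ (j == i)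
  eqsym i j = eqb-sym (toℕ i) (toℕ j)
  s : ∀ i j → a i j ≡ a j i
  s i j = cong₂ (λ x y → x ∧ not y) (∨-comm (r i j) (r j i)) (eqsym i j)
  ir : ∀ i → a i i ≡ false
  ir i rewrite eqb-refl (toℕ i) = Data.Bool.Properties.∧-zeroʳ _
    where import Data.Bool.Properties

data Walk {n : ℕ} (E : Fin n → Fin n → Bool) : Fin n → Fin n → Set where
  here : ∀ {u} → Walk E u u
  step : ∀ {u v w} → E u v ≡ true → Walk E v w → Walk E u w

Chain : ∀ {n} → (Fin n → Fin n → Bool) → List (Fin n) → Set
Chain E []           = ⊤
Chain E (x ∷ [])     = ⊤
Chain E (x ∷ y ∷ xs) = E x y ≡ true × Chain E (y ∷ xs)

IsCycle : ∀ {n} → (Fin n → Fin n → Bool) → List (Fin n) → Set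
IsCycle E []       = Data.Empty.⊥
  where import Data.Empty
IsCycle E (x ∷ xs) = 2 ≤ length xs × Unique (x ∷ xs) × Chain E ((x ∷ xs) ++ [ x ])

record Subgraph {n : ℕ} (G : Graph n) : Set where
  field
    V     : Subset n
    E     : Fin n → Fin n → Bool
    Esym  : ∀ i j → E i j ≡ E j i
    Esub  : ∀ i j → E i j ≡ true → adj G i j ≡ true × i ∈ V × j ∈ V
open Subgraph public

edgeCount : ∀ {n} → (Fin n → Fin n → Bool) → ℕ
edgeCount {n} E =
  sum (map (λ i → sum (map (λ j → cnt i j) (allFin n))) (allFin n))
  where
  cnt : Fin n → Fin n → ℕ
  cnt i j with (toℕ i <ᵇ toℕ j) ∧ E i j
  ... | true  = 1
  ... | false = 0

IsTree : ∀ {n} {G : Graph n} → Subgraph G → Set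
IsTree T =
  (∀ u v → u ∈ V T → v ∈ V T → Walk (E T) u v) ×
  (∀ xs → IsCycle (E T) xs → Data.Empty.⊥)
  where import Data.Empty

SteinerTree : ∀ {n} (G : Graph n) → Subset n → Subgraph G → Set
SteinerTree G S T = IsTree T × S ⊆ V T

SteinerDist : ∀ {n} (G : Graph n) → Subset n → ℕ → Set
SteinerDist G S m =
  Σ (Subgraph G) (λ T → SteinerTree G S T × edgeCount (E T) ≡ m) ×
  (∀ T → SteinerTree G S T → m ≤ edgeCount (E T))

SDiam : ∀ {n} → ℕ → Graph n → ℕ → Set
SDiam {n} k G m =
  Σ (Subset n) (λ S → ∣ S ∣ ≡ k × SteinerDist G S m) ×
  (∀ S → ∣ S ∣ ≡ k → ∀ m' → SteinerDist G S m' → m' ≤ m)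

Connected : ∀ {n} → Graph n → Set
Connected G = ∀ u v → Walk (adj G) u v

_≅_ : ∀ {n m} → Graph n → Graph m → Set
_≅_ {n} {m} G H =
  Σ (Fin n ↔ Fin m) λ f →
    ∀ i j → adj G i j ≡ adj H (Inverse.to f i) (Inverse.to f j)

-- The spider T_{a,b,c}: vertex 0 is v, paths P_a on 1..a,
-- P_b on a+1..a+b, P_c on a+b+1..a+b+c.

spiderRel : (a b c : ℕ) → ℕ → ℕ → Bool
spiderRel a b c x y =
  ((y ≡ᵇ suc x) ∧ not (x ≡ᵇ 0) ∧ not (x ≡ᵇ a) ∧ not (x ≡ᵇ (a + b)))
  ∨ ((x ≡ᵇ 0) ∧ (((0 <ᵇ a) ∧ (y ≡ᵇ 1))
              ∨ ((0 <ᵇ b) ∧ (y ≡ᵇ suc a))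
              ∨ ((0 <ᵇ c) ∧ (y ≡ᵇ suc (a + b)))))

Spider : (a b c : ℕ) → Graph (a + b + c + 1)
Spider a b c = fromRel (λ i j → spiderRel a b c (toℕ i) (toℕ j))

-- △_{p,q,r}: triangle on 0,1,2; paths P_p on 3..p+2 (attached to 0),
-- P_q on p+3..p+q+2 (attached to 1), P_r on p+q+3..p+q+r+2 (attached to 2).

triRel : (p q r : ℕ) → ℕ → ℕ → Bool
triRel p q r x y =
  ((x ≡ᵇ 0) ∧ (y ≡ᵇ 1)) ∨ ((x ≡ᵇ 1) ∧ (y ≡ᵇ 2)) ∨ ((x ≡ᵇ 0) ∧ (y ≡ᵇ 2))
  ∨ ((y ≡ᵇ suc x) ∧ (2 <ᵇ x) ∧ not (x ≡ᵇ (p + 2)) ∧ not (x ≡ᵇ (p + q + 2)))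
  ∨ ((0 <ᵇ p) ∧ (x ≡ᵇ 0) ∧ (y ≡ᵇ 3))
  ∨ ((0 <ᵇ q) ∧ (x ≡ᵇ 1) ∧ (y ≡ᵇ (p + 3)))
  ∨ ((0 <ᵇ r) ∧ (x ≡ᵇ 2) ∧ (y ≡ᵇ (p + q + 3)))

TriGraph : (p q r : ℕ) → Graph (p + q + r + 3)
TriGraph p q r = fromRel (λ i j → triRel p q r (toℕ i) (toℕ j))

{-# OPTIONS --safe #-}
module Submission where

-- If some set S of three terminals needs a Steiner tree with n - 1 edges, then deleting
-- any vertex must disconnect S.  Join two terminals by a path and the third one to that
-- path: this is a subdivided claw, and it contains every vertex, since a missed vertex
-- could be deleted.  A further edge would allow a deletion too, unless it joins the
-- neighbours of the branch vertex on two legs, and two such edges would allow the branch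
-- vertex itself to be deleted.  So G is a spider or a triangle with three pendant paths.
-- Conversely, in those graphs every vertex other than the three path ends separates one of
-- the ends from the others, so a tree containing the ends is spanning.

open import Defs renaming (sym to adj-sym)
open import Data.Bool using (Bool; true; false; _∧_; _∨_; not; T; if_then_else_) renaming (_≟_ to _≟ᵇ_)
open import Data.Bool.Properties using (∨-zeroʳ; ∨-identityʳ)
open import Data.Empty using (⊥; ⊥-elim)
open import Data.Fin using (Fin; zero; suc; toℕ; fromℕ<)
open import Data.Fin.Patterns using (0F; 1F; 2F)
open import Data.Fin.Permutation using (Permutation′; _⟨$⟩ʳ_; _⟨$⟩ˡ_; inverseʳ; transpose; _∘ₚ_; ↔⇒≡) renaming (id to idₚ)
open import Data.Fin.Properties using (_≟_; any?; suc-injective; toℕ-injective; toℕ<n; toℕ-fromℕ<)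
open import Data.Fin.Subset using (Subset; _∈_; _∉_; _⊆_; _∪_; ⁅_⁆; ∣_∣; inside; outside; ⊤) renaming (⊥ to ∅)
open import Data.Fin.Subset.Properties using (_∈?_; x∈⁅x⁆; x∈⁅y⁆⇒x≡y; ∣⁅x⁆∣≡1; x∈p∪q⁻; x∈p∪q⁺; ∪-identityʳ; p⊂q⇒∣p∣<∣q∣; ∣⊤∣≡n; ∈⊤; ∉⊥; ∣⊥∣≡0; p⊆q⇒∣p∣≤∣q∣; ∣p∣≤n)
open import Data.List using ([]; _∷_; _++_; [_]; length; map; allFin)
open import Data.List.Properties using (map-cong; map-tabulate)
open import Data.List.Membership.Propositional using () renaming (_∈_ to _∈ˡ_)
open import Data.List.Membership.Propositional.Properties using (∈-++⁻)
open import Data.List.Relation.Unary.All as All using (All; []; _∷_)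
open import Data.List.Relation.Unary.AllPairs using (_∷_)
open import Data.List.Relation.Unary.Any using (here; there) renaming (any? to anyˡ?)
open import Data.List.Relation.Unary.Unique.Propositional using (Unique)
open import Data.Nat using (ℕ; zero; suc; _+_; _∸_; _≤_; _<_; z≤n; s≤s; pred; _≤′_; ≤′-refl; ≤′-step; _≤?_; _<?_; _≡ᵇ_; _<ᵇ_)
open import Data.Nat.ListAction using (sum)
open import Data.Nat.Properties using (+-mono-≤; <⇒≯; <⇒<ᵇ; <ᵇ⇒<; ≡ᵇ⇒≡; ≡⇒≡ᵇ; ≤-refl; ≤-antisym; ≤-trans; ≤-reflexive; ≤-total; <⇒≱; m≤n⇒m<n∨m≡n; m<n⇒m<1+n; <⇒≤; ≤-pred; anyUpTo?; ≤⇒≤′; ≤′⇒≤; n≤1+n; <-cmp; +-suc; +-comm; +-identityʳ; +-cancelˡ-≡; +-cancelˡ-<; m+[n∸m]≡n; m≤m+n; m∸n≤m; +-monoʳ-≤; +-monoʳ-<; n∸n≡0; m∸[m∸n]≡n; +-∸-assoc; n≮n; ≰⇒>; ≮⇒≥; m≤n⇒m≤1+n; <-≤-trans; m+n≡0⇒n≡0; m+n≡0⇒m≡0; n<1⇒n≡0; ∸-monoˡ-≤; ∸-monoˡ-<; <⇒≢; ≤∧≢⇒<; 1+n≢n; n≤0⇒n≡0; n≢0⇒n>0; m+n∸n≡m)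
open import Data.Product using (Σ; ∃; ∃₂; _×_; _,_; proj₁; proj₂; map₂; swap)
open import Data.Sum using (_⊎_; inj₁; inj₂; map₁) renaming ([_,_] to either)
open import Data.Unit using (tt)
open import Data.Vec using ([]; _∷_; here; there)
open import Function using (_∘_; id; case_of_)
open import Function.Bundles using (_↔_; _⇔_; mk⇔; mk↔ₛ′; Inverse; Injection)
open import Function.Definitions using (Injective)
open import Function.Properties.Inverse using (↔-sym; ↔⇒↣)
open import Level using (0ℓ)
open import Relation.Binary using (Rel; Symmetric; tri<; tri≈; tri>)
open import Relation.Binary.Construct.Closure.ReflexiveTransitive using (Star; ε; _◅_; _◅◅_)
open import Relation.Binary.PropositionalEquality using (_≡_; _≢_; refl; sym; trans; cong; cong₂; subst; subst₂)
open import Relation.Nullary using (¬_; ¬?; Dec; does; yes; no; contradiction)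
open import Relation.Nullary.Decidable using (_×-dec_; dec-true; dec-false)
open import Relation.Unary using (Decidable)

-- A tree is specified by walks and the absence of cycles, which does not give its number of edges
-- directly. Every tree built here is therefore grown leaf by leaf, so that acyclicity and the count
-- follow by induction, and a lower bound for an arbitrary tree comes from a grown tree inside it.
-- Spiders and triangles with pendant paths share one description: three legs with labelled
-- vertices, whose roots either all coincide or are all distinct. The separation argument for the
-- converse and the comparison with the numbered models are then done once for both families. Legs
-- may have length zero. This covers `T_{0,b,c}`, where one terminal lies on the path between the
-- other two, and it makes a triangle arise from a claw with a chord by moving two roots one vertex
-- outwards.

EdgeSet : ℕ → Set
EdgeSet n = Fin n → Fin n → Bool

-- Counting edges

sumFin : ∀ {n} → (Fin n → ℕ) → ℕ
sumFin {n} f = sum (map f (allFin n))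

sumFin-suc : ∀ {n} (f : Fin (suc n) → ℕ) → sumFin f ≡ f zero + sumFin (f ∘ suc)
sumFin-suc f = cong (λ xs → f zero + sum xs)
  (trans (map-tabulate suc f) (sym (map-tabulate id (f ∘ suc))))

sumFin-cong : ∀ {n} {f g : Fin n → ℕ} → (∀ i → f i ≡ g i) → sumFin f ≡ sumFin g
sumFin-cong {n} f≗g = cong sum (map-cong f≗g (allFin n))

sumFin-mono : ∀ {n} {f g : Fin n → ℕ} → (∀ i → f i ≤ g i) → sumFin f ≤ sumFin g
sumFin-mono {zero} f≤g = z≤n
sumFin-mono {suc n} {f} {g} f≤g = subst₂ _≤_ (sym (sumFin-suc f)) (sym (sumFin-suc g))
  (+-mono-≤ (f≤g zero) (sumFin-mono (f≤g ∘ suc)))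

sumFin-zero : ∀ {n} {f : Fin n → ℕ} → (∀ i → f i ≡ 0) → sumFin f ≡ 0
sumFin-zero {zero} f≡0 = refl
sumFin-zero {suc n} {f} f≡0 = trans (sumFin-suc f)
  (cong₂ _+_ (f≡0 zero) (sumFin-zero (f≡0 ∘ suc)))

sumFin-increment : ∀ {n} {f g : Fin n → ℕ} x → g x ≡ suc (f x) →
  (∀ i → i ≢ x → g i ≡ f i) → sumFin g ≡ suc (sumFin f)
sumFin-increment {f = f} {g} zero gx g≗f = trans (sumFin-suc g) (trans
  (cong₂ _+_ gx (sumFin-cong (λ i → g≗f (suc i) λ ())))
  (cong suc (sym (sumFin-suc f))))
sumFin-increment {f = f} {g} (suc x) gx g≗f = trans (sumFin-suc g) (trans
  (cong₂ _+_ (g≗f zero λ ())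
    (sumFin-increment x gx (λ i i≢x → g≗f (suc i) (i≢x ∘ suc-injective))))
  (trans (+-suc _ _) (cong suc (sym (sumFin-suc f)))))

bit : Bool → ℕ
bit true  = 1
bit false = 0

edgeBit : ∀ {n} → EdgeSet n → Fin n → Fin n → ℕ
edgeBit E i j = bit ((toℕ i <ᵇ toℕ j) ∧ E i j)

-- The summand of edgeCount is a where-function without an accessible name:
-- the type of edgeBit-correct is inferred from its use in edgeCount-bits.
mutual
  edgeCount-bits : ∀ {n} (E : EdgeSet n) → edgeCount E ≡ sumFin (λ i → sumFin (edgeBit E i))
  edgeCount-bits {n} E = sumFin-cong (λ i → sumFin-cong (λ j → edgeBit-correct E i j))

  edgeBit-correct : ∀ {n} (E : EdgeSet n) i j → _ ≡ edgeBit E i j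
  edgeBit-correct E i j with (toℕ i <ᵇ toℕ j) ∧ E i j
  ... | true  = refl
  ... | false = refl

bit-mono : ∀ c {a b} → (a ≡ true → b ≡ true) → bit (c ∧ a) ≤ bit (c ∧ b)
bit-mono false     a⇒b = z≤n
bit-mono true {false} a⇒b = z≤n
bit-mono true {true}  a⇒b rewrite a⇒b refl = ≤-refl

edgeCount-mono : ∀ {n} (E F : EdgeSet n) → (∀ i j → E i j ≡ true → F i j ≡ true) →
  edgeCount E ≤ edgeCount F
edgeCount-mono E F E⊆F = subst₂ _≤_ (sym (edgeCount-bits E)) (sym (edgeCount-bits F))
  (sumFin-mono λ i → sumFin-mono λ j → bit-mono (toℕ i <ᵇ toℕ j) (E⊆F i j))

edgeCount-∅ : ∀ {n} → edgeCount {n} (λ _ _ → false) ≡ 0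
edgeCount-∅ {n} = trans (edgeCount-bits {n} (λ _ _ → false))
  (sumFin-zero {n} λ i → sumFin-zero {n} λ j → noBit (toℕ i <ᵇ toℕ j))
  where
  noBit : ∀ b → bit (b ∧ false) ≡ 0
  noBit true  = refl
  noBit false = refl

T⇒≡true : ∀ {b} → T b → b ≡ true
T⇒≡true {true} _ = refl

≡true⇒T : ∀ {b} → b ≡ true → T b
≡true⇒T refl = tt

edgeCount-increment : ∀ {n} (E F : EdgeSet n) x y → toℕ x < toℕ y →
  E x y ≡ false → F x y ≡ true →
  (∀ i j → toℕ i < toℕ j → ¬ (i ≡ x × j ≡ y) → F i j ≡ E i j) →
  edgeCount F ≡ suc (edgeCount E)
edgeCount-increment E F x y x<y Exy Fxy agree = trans (edgeCount-bits F) (trans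
  (sumFin-increment x
    (sumFin-increment y atEdge (λ j j≢y → offEdge x j (j≢y ∘ proj₂)))
    (λ i i≢x → sumFin-cong (λ j → offEdge i j (i≢x ∘ proj₁))))
  (cong suc (sym (edgeCount-bits E))))
  where
  atEdge : edgeBit F x y ≡ suc (edgeBit E x y)
  atEdge rewrite T⇒≡true (<⇒<ᵇ x<y) | Exy | Fxy = refl
  offEdge : ∀ i j → ¬ (i ≡ x × j ≡ y) → edgeBit F i j ≡ edgeBit E i j
  offEdge i j off with toℕ i <ᵇ toℕ j in eq
  ... | false = refl
  ... | true  = cong bit (agree i j (<ᵇ⇒< _ _ (≡true⇒T eq)) off)

∨-true⁻ : ∀ a {b} → a ∨ b ≡ true → a ≡ true ⊎ b ≡ true
∨-true⁻ true  eq = inj₁ refl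
∨-true⁻ false eq = inj₂ eq

∨-trueˡ : ∀ {a b} → a ≡ true → a ∨ b ≡ true
∨-trueˡ refl = refl

∨-trueʳ : ∀ a {b} → b ≡ true → a ∨ b ≡ true
∨-trueʳ a refl = ∨-zeroʳ a

does-true⁻ : ∀ {P : Set} (P? : Dec P) → does P? ≡ true → P
does-true⁻ (yes p) _ = p

link : ∀ {n} → Fin n → Fin n → EdgeSet n → EdgeSet n
link x y E i j = E i j ∨ does (i ≟ x ×-dec j ≟ y) ∨ does (i ≟ y ×-dec j ≟ x)

module _ {n} (x y : Fin n) (E : EdgeSet n) where

  link⁻ : ∀ {i j} → link x y E i j ≡ true →
    E i j ≡ true ⊎ (i ≡ x × j ≡ y) ⊎ (i ≡ y × j ≡ x)
  link⁻ {i} {j} eq with ∨-true⁻ (E i j) eq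
  ... | inj₁ e = inj₁ e
  ... | inj₂ e with ∨-true⁻ (does (i ≟ x ×-dec j ≟ y)) e
  ...   | inj₁ e′ = inj₂ (inj₁ (does-true⁻ (i ≟ x ×-dec j ≟ y) e′))
  ...   | inj₂ e′ = inj₂ (inj₂ (does-true⁻ (i ≟ y ×-dec j ≟ x) e′))

  link-old : ∀ {i j} → E i j ≡ true → link x y E i j ≡ true
  link-old = ∨-trueˡ

  link-new : link x y E x y ≡ true
  link-new = ∨-trueʳ (E x y) (∨-trueˡ (dec-true (x ≟ x ×-dec y ≟ y) (refl , refl)))

  link-new′ : link x y E y x ≡ true
  link-new′ = ∨-trueʳ (E y x) (∨-trueʳ (does (y ≟ x ×-dec x ≟ y))
    (dec-true (y ≟ y ×-dec x ≟ x) (refl , refl)))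

  link-other : ∀ {i j} → ¬ (i ≡ x × j ≡ y) → ¬ (i ≡ y × j ≡ x) → link x y E i j ≡ E i j
  link-other {i} {j} ¬xy ¬yx
    rewrite dec-false (i ≟ x ×-dec j ≟ y) ¬xy | dec-false (i ≟ y ×-dec j ≟ x) ¬yx = ∨-identityʳ (E i j)

  -- `edgeCount` looks only at pairs with the smaller vertex first, so exactly one of the two
  -- entries set by `link` is counted; the order of `x` and `y` decides which.
  edgeCount-link : x ≢ y → E x y ≡ false → E y x ≡ false →
    edgeCount (link x y E) ≡ suc (edgeCount E)
  edgeCount-link x≢y Exy Eyx with <-cmp (toℕ x) (toℕ y)
  ... | tri< x<y _ _ = edgeCount-increment E (link x y E) x y x<y Exy link-new
        λ i j i<j off → link-other off λ { (refl , refl) → <⇒≯ i<j x<y }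
  ... | tri≈ _ x≡y _ = contradiction (toℕ-injective x≡y) x≢y
  ... | tri> _ _ y<x = edgeCount-increment E (link x y E) y x y<x Eyx link-new′
        λ i j i<j off → link-other (λ { (refl , refl) → <⇒≯ i<j y<x }) off

-- Cycles

module _ {n} {E : EdgeSet n} where

  -- The neighbours found are the predecessor and the successor in the chain. The ends may coincide,
  -- as they do when a cycle is closed; then at least two interior vertices are needed to keep the
  -- two neighbours apart.
  chain-neighbours : ∀ a ys b {x} → x ∈ˡ ys → Chain E (a ∷ ys ++ [ b ]) →
    Unique (a ∷ ys) → All (_≢ b) ys → a ≢ b ⊎ 2 ≤ length ys →
    ∃₂ λ u v → u ≢ v × E u x ≡ true × E x v ≡ true
  chain-neighbours a (y ∷ []) b (here refl) (Eay , Eyb , _) _ _ (inj₁ a≢b) =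
    a , b , a≢b , Eay , Eyb
  chain-neighbours a (y ∷ []) b (here refl) _ _ _ (inj₂ (s≤s ()))
  chain-neighbours a (y ∷ z ∷ ys) b (here refl) (Eay , Eyz , _) ((_ ∷ a≢z ∷ _) ∷ _) _ _ =
    a , z , a≢z , Eay , Eyz
  chain-neighbours a (y ∷ ys@(_ ∷ _)) b (there x∈ys) (_ , chain) (_ ∷ uniq) (y≢b ∷ ys≢b) _ =
    chain-neighbours y ys b x∈ys chain uniq ys≢b (inj₁ y≢b)

  chain-penultimate : ∀ a y ys b → Chain E (a ∷ (y ∷ ys) ++ [ b ]) →
    ∃ λ u → u ∈ˡ (y ∷ ys) × E u b ≡ true
  chain-penultimate a y []       b (_ , Eyb , _) = y , here refl , Eyb
  chain-penultimate a y (z ∷ ys) b (_ , chain) with chain-penultimate y z ys b chain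
  ... | u , u∈ , Eub = u , there u∈ , Eub

  -- The head stands at both ends of the closed chain, so its predecessor is the penultimate entry;
  -- every other vertex is interior. This is what keeps a leaf off all cycles.
  cycle-neighbours : ∀ {cs x} → IsCycle E cs → x ∈ˡ cs →
    ∃₂ λ u v → u ≢ v × E u x ≡ true × E x v ≡ true
  cycle-neighbours {c ∷ y ∷ z ∷ ys} (_ , (_ ∷ y≢ ∷ _) , Ecy , chain) (here refl)
    with chain-penultimate y z ys c chain
  ... | u , u∈ , Euc = u , y , (λ { refl → All.lookup y≢ u∈ refl }) , Euc , Ecy
  cycle-neighbours {c ∷ y ∷ []} (s≤s () , _) _
  cycle-neighbours {c ∷ cs} (2≤ , uniq@(c≢ ∷ _) , chain) (there x∈) =
    chain-neighbours c cs c x∈ chain uniq (All.map (λ c≢y y≡c → c≢y (sym y≡c)) c≢) (inj₂ 2≤)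

  chain-map : ∀ {F : EdgeSet n} {P : Fin n → Set} →
    (∀ {i j} → P i → P j → E i j ≡ true → F i j ≡ true) →
    ∀ xs → All P xs → Chain E xs → Chain F xs
  chain-map f []           _              _             = tt
  chain-map f (x ∷ [])     _              _             = tt
  chain-map f (x ∷ y ∷ xs) (px ∷ py ∷ ps) (Exy , chain) =
    f px py Exy , chain-map f (y ∷ xs) (py ∷ ps) chain

-- Trees grown from a root by adding leaves

∣p∪⁅x⁆∣≡suc∣p∣ : ∀ {n} {p : Subset n} {x} → x ∉ p → ∣ p ∪ ⁅ x ⁆ ∣ ≡ suc ∣ p ∣
∣p∪⁅x⁆∣≡suc∣p∣ {p = inside  ∷ p} {zero}  x∉p = contradiction here x∉p
∣p∪⁅x⁆∣≡suc∣p∣ {p = outside ∷ p} {zero}  x∉p = cong (λ q → suc ∣ q ∣) (∪-identityʳ p)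
∣p∪⁅x⁆∣≡suc∣p∣ {p = inside  ∷ p} {suc x} x∉p = cong suc (∣p∪⁅x⁆∣≡suc∣p∣ (x∉p ∘ there))
∣p∪⁅x⁆∣≡suc∣p∣ {p = outside ∷ p} {suc x} x∉p = ∣p∪⁅x⁆∣≡suc∣p∣ (x∉p ∘ there)

-- The index is the vertex set. In `grow`, `x` is the new leaf and `y` its parent, so a derivation
-- also stores the edges, which `edges` reads off.
data Grown {n} (R : Rel (Fin n) 0ℓ) (r : Fin n) : Subset n → Set where
  root : Grown R r ⁅ r ⁆
  grow : ∀ {p x y} → Grown R r p → x ∉ p → y ∈ p → R y x → Grown R r (p ∪ ⁅ x ⁆)

module _ {n} {R : Rel (Fin n) 0ℓ} {r : Fin n} where

  edges : ∀ {p} → Grown R r p → EdgeSet n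
  edges root                     = λ _ _ → false
  edges (grow {x = x} {y} t _ _ _) = link x y (edges t)

  edges-vertices : ∀ {p} (t : Grown R r p) {i j} → edges t i j ≡ true → i ∈ p × j ∈ p
  edges-vertices (grow {p} {x} {y} t x∉p y∈p _) e with link⁻ x y (edges t) e
  ... | inj₁ e′ = let i∈p , j∈p = edges-vertices t e′ in x∈p∪q⁺ (inj₁ i∈p) , x∈p∪q⁺ (inj₁ j∈p)
  ... | inj₂ (inj₁ (refl , refl)) = x∈p∪q⁺ (inj₂ (x∈⁅x⁆ x)) , x∈p∪q⁺ (inj₁ y∈p)
  ... | inj₂ (inj₂ (refl , refl)) = x∈p∪q⁺ (inj₁ y∈p) , x∈p∪q⁺ (inj₂ (x∈⁅x⁆ x))

  edges-⊆ : Symmetric R → ∀ {p} (t : Grown R r p) {i j} → edges t i j ≡ true → R i j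
  edges-⊆ R-sym (grow {x = x} {y} t _ _ Ryx) e with link⁻ x y (edges t) e
  ... | inj₁ e′ = edges-⊆ R-sym t e′
  ... | inj₂ (inj₁ (refl , refl)) = R-sym Ryx
  ... | inj₂ (inj₂ (refl , refl)) = Ryx

  edges-symmetric : ∀ {p} (t : Grown R r p) {i j} → edges t i j ≡ true → edges t j i ≡ true
  edges-symmetric (grow {x = x} {y} t _ _ _) e with link⁻ x y (edges t) e
  ... | inj₁ e′ = link-old x y (edges t) (edges-symmetric t e′)
  ... | inj₂ (inj₁ (refl , refl)) = link-new′ x y (edges t)
  ... | inj₂ (inj₂ (refl , refl)) = link-new x y (edges t)

  edges-outside : ∀ {p} (t : Grown R r p) {i j} → ¬ (i ∈ p × j ∈ p) → edges t i j ≡ false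
  edges-outside t {i} {j} ¬∈ with edges t i j in eq
  ... | false = refl
  ... | true  = contradiction (edges-vertices t eq) ¬∈

  edgeCount-edges : ∀ {p} (t : Grown R r p) → suc (edgeCount (edges t)) ≡ ∣ p ∣
  edgeCount-edges root = trans (cong suc (edgeCount-∅ {n})) (sym (∣⁅x⁆∣≡1 r))
  edgeCount-edges (grow {x = x} {y} t x∉p y∈p _) = trans
    (cong suc (edgeCount-link x y (edges t) (λ { refl → x∉p y∈p })
      (edges-outside t (x∉p ∘ proj₁)) (edges-outside t (x∉p ∘ proj₂))))
    (trans (cong suc (edgeCount-edges t)) (sym (∣p∪⁅x⁆∣≡suc∣p∣ x∉p)))

  -- A cycle through the newest leaf would give it two neighbours, although only its parent is
  -- adjacent to it. Any other cycle already lies in the smaller tree.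
  edges-acyclic : ∀ {p} (t : Grown R r p) cs → ¬ IsCycle (edges t) cs
  edges-acyclic root (c ∷ y ∷ cs) (_ , _ , () , _)
  edges-acyclic root (c ∷ []) (() , _)
  edges-acyclic (grow {p} {x} {y} t x∉p y∈p _) cs cycle with anyˡ? (x ≟_) cs
  ... | yes x∈cs = let u , v , u≢v , Eux , Exv = cycle-neighbours cycle x∈cs in
        u≢v (trans (into Eux) (sym (out Exv)))
    where
    -- x has degree one, with y as its only neighbour.
    out : ∀ {v} → link x y (edges t) x v ≡ true → v ≡ y
    out e with link⁻ x y (edges t) e
    ... | inj₁ e′ = contradiction (proj₁ (edges-vertices t e′)) x∉p
    ... | inj₂ (inj₁ (_ , v≡y)) = v≡y
    ... | inj₂ (inj₂ (refl , _)) = contradiction y∈p x∉p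
    into : ∀ {u} → link x y (edges t) u x ≡ true → u ≡ y
    into e with link⁻ x y (edges t) e
    ... | inj₁ e′ = contradiction (proj₂ (edges-vertices t e′)) x∉p
    ... | inj₂ (inj₁ (_ , refl)) = contradiction y∈p x∉p
    ... | inj₂ (inj₂ (u≡y , _)) = u≡y
  ... | no x∉cs = edges-acyclic t cs (restrict cs x∉cs cycle)
    where
    old : ∀ {i j} → i ≢ x → j ≢ x → link x y (edges t) i j ≡ true → edges t i j ≡ true
    old i≢x j≢x e with link⁻ x y (edges t) e
    ... | inj₁ e′ = e′
    ... | inj₂ (inj₁ (i≡x , _)) = contradiction i≡x i≢x
    ... | inj₂ (inj₂ (_ , j≡x)) = contradiction j≡x j≢x
    restrict : ∀ cs → ¬ x ∈ˡ cs → IsCycle (link x y (edges t)) cs → IsCycle (edges t) cs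
    restrict (c ∷ cs) x∉ (2≤ , uniq , chain) = 2≤ , uniq , chain-map old _
      (All.tabulate λ z∈ z≡x → x∉ (closed cs (subst (_∈ˡ _) z≡x z∈))) chain
      where
      closed : ∀ cs {z} → z ∈ˡ (c ∷ cs) ++ [ c ] → z ∈ˡ (c ∷ cs)
      closed cs z∈ with ∈-++⁻ (c ∷ cs) z∈
      ... | inj₁ z∈′ = z∈′
      ... | inj₂ (here refl) = here refl

  from-root : ∀ {p} (t : Grown R r p) {v} → v ∈ p → Walk (edges t) r v
  from-root root v∈ with x∈⁅y⁆⇒x≡y r v∈
  ... | refl = here
  from-root (grow {p} {x} {y} t x∉p y∈p _) v∈ with x∈p∪q⁻ p ⁅ x ⁆ v∈
  ... | inj₁ v∈p = weaken (from-root t v∈p)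
    where
    weaken : ∀ {u v} → Walk (edges t) u v → Walk (link x y (edges t)) u v
    weaken here       = here
    weaken (step e w) = step (link-old x y (edges t) e) (weaken w)
  ... | inj₂ v∈x with x∈⁅y⁆⇒x≡y x v∈x
  ...   | refl = extend (from-root t y∈p)
    where
    extend : ∀ {u} → Walk (edges t) u y → Walk (link x y (edges t)) u x
    extend here       = step (link-new′ x y (edges t)) here
    extend (step e w) = step (link-old x y (edges t) e) (extend w)

  -- The walk is followed vertex by vertex: a vertex outside the tree becomes a leaf on its
  -- predecessor, and one inside it adds nothing.
  absorb : ∀ {p y x} → Grown R r p → y ∈ p → Star R y x →
    ∃ λ q → Grown R r q × p ⊆ q × x ∈ q
  absorb {p} t y∈p ε = p , t , id , y∈p
  absorb {p} t y∈p (_◅_ {j = z} Ryz walk) with z ∈? p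
  ... | yes z∈p = absorb t z∈p walk
  ... | no  z∉p with absorb (grow t z∉p y∈p Ryz) (x∈p∪q⁺ (inj₂ (x∈⁅x⁆ z))) walk
  ...   | q , t′ , ⊆q , x∈q = q , t′ , ⊆q ∘ x∈p∪q⁺ ∘ inj₁ , x∈q

  root∈ : ∀ {p} → Grown R r p → r ∈ p
  root∈ root           = x∈⁅x⁆ r
  root∈ (grow t _ _ _) = x∈p∪q⁺ (inj₁ (root∈ t))

  -- With `id` for `s` this yields spanning trees, with the terminals for `s` Steiner trees.
  grow-to : ∀ {k} (s : Fin k → Fin n) → (∀ i → Star R r (s i)) →
    ∃ λ q → Grown R r q × (∀ i → s i ∈ q)
  grow-to {zero}  s walks = ⁅ r ⁆ , root , λ ()
  grow-to {suc k} s walks =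
    let p , t , s∈p = grow-to (s ∘ suc) (walks ∘ suc)
        q , t′ , p⊆q , s₀∈q = absorb t (root∈ t) (walks zero)
    in q , t′ , λ { zero → s₀∈q ; (suc i) → p⊆q (s∈p i) }

  Grown-avoids : ∀ {w} → r ≢ w → (∀ {y} → ¬ R y w) → ∀ {p} → Grown R r p → w ∉ p
  Grown-avoids r≢w ¬R root w∈ = r≢w (sym (x∈⁅y⁆⇒x≡y r w∈))
  Grown-avoids r≢w ¬R (grow {p} {x} t _ _ Ryx) w∈ with x∈p∪q⁻ p ⁅ x ⁆ w∈
  ... | inj₁ w∈p = Grown-avoids r≢w ¬R t w∈p
  ... | inj₂ w∈x with x∈⁅y⁆⇒x≡y x w∈x
  ...   | refl = ¬R Ryx

-- Spanning trees, terminal sets and vertex deletion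

Adj : ∀ {n} → Graph n → Rel (Fin n) 0ℓ
Adj G x y = adj G x y ≡ true

Adj-sym : ∀ {n} (G : Graph n) → Symmetric (Adj G)
Adj-sym G {x} {y} e = trans (adj-sym G y x) e

walk⇒star : ∀ {n} {E : EdgeSet n} {u v} → Walk E u v → Star (λ x y → E x y ≡ true) u v
walk⇒star here       = ε
walk⇒star (step e w) = e ◅ walk⇒star w

walk-reverse : ∀ {n} {E : EdgeSet n} → (∀ {x y} → E x y ≡ true → E y x ≡ true) →
  ∀ {u v w} → Walk E u v → Walk E u w → Walk E v w
walk-reverse E-sym here       w′ = w′
walk-reverse E-sym (step e w) w′ = walk-reverse E-sym w (step (E-sym e) w′)

∣p∣≡n : ∀ {n} (p : Subset n) → (∀ x → x ∈ p) → ∣ p ∣ ≡ n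
∣p∣≡n {n} p all = ≤-antisym (∣p∣≤n p)
  (subst (_≤ ∣ p ∣) (∣⊤∣≡n n) (p⊆q⇒∣p∣≤∣q∣ {p = ⊤} {p} (λ {x} _ → all x)))

bool-≡ : ∀ {a b} → (a ≡ true → b ≡ true) → (b ≡ true → a ≡ true) → a ≡ b
bool-≡ {true}  {b}     f g = sym (f refl)
bool-≡ {false} {true}  f g = g refl
bool-≡ {false} {false} f g = refl

module _ {n} (G : Graph n) where

  grown-tree : ∀ {R r p} → Symmetric R → (∀ {x y} → R x y → Adj G x y) → Grown R r p →
    Σ (Subgraph G) λ T → IsTree T × V T ≡ p × suc (edgeCount (E T)) ≡ ∣ p ∣
  grown-tree {p = p} R-sym R⊆G t =
    record { V = p ; E = edges t
           ; Esym = λ i j → bool-≡ (edges-symmetric t) (edges-symmetric t)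
           ; Esub = λ i j e → R⊆G (edges-⊆ R-sym t e) , edges-vertices t e } ,
    ((λ u v u∈ v∈ → walk-reverse (edges-symmetric t) (from-root t u∈) (from-root t v∈)) ,
     edges-acyclic t) ,
    refl , edgeCount-edges t

  spanning-tree : Connected G → Fin n →
    Σ (Subgraph G) λ T → IsTree T × (∀ x → x ∈ V T) × edgeCount (E T) ≡ n ∸ 1
  spanning-tree conn r =
    let p , t , all = grow-to id (λ x → walk⇒star (conn r x))
        T , tree , V≡p , count = grown-tree (Adj-sym G) id t
    in T , tree , (λ x → subst (x ∈_) (sym V≡p) (all x)) ,
       cong pred (trans count (∣p∣≡n p all))

-- A tree grown along the walks uses edges of `E` only and reaches every vertex, so it already
-- accounts for `n ∸ 1` edges.
connected-edgeCount : ∀ {n} (E : EdgeSet n) → (∀ {x y} → E x y ≡ true → E y x ≡ true) →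
  ∀ r → (∀ x → Walk E r x) → n ∸ 1 ≤ edgeCount E
connected-edgeCount E E-sym r walks =
  let p , t , all = grow-to id (λ x → walk⇒star (walks x))
  in subst (_≤ edgeCount E) (cong pred (trans (edgeCount-edges t) (∣p∣≡n p all)))
       (edgeCount-mono (edges t) E λ i j → edges-⊆ E-sym t)

-- Terminals are handled as an injective family, so that a terminal and the leg leading to it share
-- an index; `image` goes back to subsets for the converse.
enumerate : ∀ {n} (S : Subset n) → ∃ λ (s : Fin ∣ S ∣ → Fin n) →
  Injective _≡_ _≡_ s × (∀ {x} → x ∈ S → ∃ λ i → x ≡ s i)
enumerate [] = (λ ()) , (λ { {()} }) , λ ()
enumerate (outside ∷ S) with enumerate S
... | s , inj , onto = suc ∘ s , inj ∘ suc-injective ,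
      λ { (there x∈) → let i , eq = onto x∈ in i , cong suc eq }
enumerate (inside ∷ S) with enumerate S
... | s , inj , onto = s′ , inj′ , onto′
  where
  s′ : Fin (suc ∣ S ∣) → Fin _
  s′ zero    = zero
  s′ (suc i) = suc (s i)
  inj′ : Injective _≡_ _≡_ s′
  inj′ {zero}  {zero}  eq = refl
  inj′ {suc i} {suc j} eq = cong suc (inj (suc-injective eq))
  onto′ : ∀ {x} → x ∈ inside ∷ S → ∃ λ i → x ≡ s′ i
  onto′ here       = zero , refl
  onto′ (there x∈) = let i , eq = onto x∈ in suc i , cong suc eq

image : ∀ {n k} (s : Fin k → Fin n) → Injective _≡_ _≡_ s →
  ∃ λ S → ∣ S ∣ ≡ k × (∀ i → s i ∈ S) × (∀ {x} → x ∈ S → ∃ λ i → x ≡ s i)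
image {n} {zero} s inj = ∅ , ∣⊥∣≡0 n , (λ ()) , λ x∈ → contradiction x∈ ∉⊥
image {n} {suc k} s inj with image (s ∘ suc) (suc-injective ∘ inj)
... | S , size , s∈S , S⊆s = S ∪ ⁅ s zero ⁆ ,
      trans (∣p∪⁅x⁆∣≡suc∣p∣ fresh) (cong suc size) ,
      (λ { zero → x∈p∪q⁺ (inj₂ (x∈⁅x⁆ _)) ; (suc i) → x∈p∪q⁺ (inj₁ (s∈S i)) }) , back
  where
  fresh : s zero ∉ S
  fresh s₀∈ with S⊆s s₀∈
  ... | i , eq with inj eq
  ...   | ()
  back : ∀ {x} → x ∈ S ∪ ⁅ s zero ⁆ → ∃ λ i → x ≡ s i
  back x∈ with x∈p∪q⁻ S ⁅ s zero ⁆ x∈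
  ... | inj₁ x∈S = let i , eq = S⊆s x∈S in suc i , eq
  ... | inj₂ x∈s = zero , x∈⁅y⁆⇒x≡y _ x∈s

Deleted : ∀ {n} → Graph n → Fin n → Rel (Fin n) 0ℓ
Deleted G w x y = Adj G x y × x ≢ w × y ≢ w

Deleted-sym : ∀ {n} (G : Graph n) w → Symmetric (Deleted G w)
Deleted-sym G w (xy , x≢w , y≢w) = Adj-sym G xy , y≢w , x≢w

-- The empty walk at `w` survives the deletion, hence the condition `r ≢ w`. A walk from such an `r`
-- never ends in `w`, so the condition has content only when `w` is not a terminal.
Separating : ∀ {n k} → Graph n → (Fin k → Fin n) → Set
Separating G s = ∀ {w r} → r ≢ w → ¬ (∀ i → Star (Deleted G w) r (s i))

-- Walks avoiding `w` would let a tree containing all terminals grow without `w`; with fewer than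
-- `n` vertices it has fewer than `n ∸ 1` edges.
large-steiner⇒separating : ∀ {n k} (G : Graph n) S (s : Fin k → Fin n) →
  (∀ {x} → x ∈ S → ∃ λ i → x ≡ s i) →
  (∀ T → SteinerTree G S T → n ∸ 1 ≤ edgeCount (E T)) → Separating G s
large-steiner⇒separating {n} G S s S⊆s large {w} {r} r≢w walks =
  let p , t , s∈p = grow-to s walks
      T , tree , V≡p , count = grown-tree G (Deleted-sym G w) proj₁ t
      S⊆V : S ⊆ V T
      S⊆V x∈ = let i , eq = S⊆s x∈ in subst₂ _∈_ (sym eq) (sym V≡p) (s∈p i)
      w∉p = Grown-avoids r≢w (λ { (_ , _ , w≢w) → w≢w refl }) t
      p<n = subst (∣ p ∣ <_) (∣⊤∣≡n n) (p⊂q⇒∣p∣<∣q∣ {p = p} {⊤} ((λ _ → ∈⊤) , w , ∈⊤ , w∉p))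
  in <⇒≱ (∸-monoˡ-≤ 1 (subst (_< n) (sym count) p<n)) (large T (tree , S⊆V))

-- Three paths hanging off a single vertex or off the vertices of a triangle:
-- at i k is the vertex at distance k from the root at i 0 of the i-th path, and
-- it is meaningless for k > len i.  Root edges exist only when roots differ.

Arc : ∀ {n} → (Fin 3 → ℕ → Fin n) → (Fin 3 → ℕ) → Rel (Fin n) 0ℓ
Arc at len x y = ∃₂ λ i k → k < len i × x ≡ at i k × y ≡ at i (suc k)

RootEdge : ∀ {n} → (Fin 3 → ℕ → Fin n) → Rel (Fin n) 0ℓ
RootEdge at x y = ∃₂ λ i j → x ≡ at i 0 × y ≡ at j 0 × x ≢ y

Edge : ∀ {n} → (Fin 3 → ℕ → Fin n) → (Fin 3 → ℕ) → Rel (Fin n) 0ℓ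
Edge at len x y = Arc at len x y ⊎ Arc at len y x ⊎ RootEdge at x y

record Tripod {n} (G : Graph n) : Set where
  field
    at        : Fin 3 → ℕ → Fin n
    len       : Fin 3 → ℕ
    -- Different labels may name one vertex only if both are roots; which roots coincide is left
    -- open, so that one record serves both families.
    injective : ∀ {i j k l} → k ≤ len i → l ≤ len j → at i k ≡ at j l → k ≡ l × (i ≡ j ⊎ k ≡ 0)
    cover     : ∀ x → ∃₂ λ i k → k ≤ len i × at i k ≡ x
    adj⇒edge  : ∀ {x y} → Adj G x y → Edge at len x y
    edge⇒adj  : ∀ {x y} → Edge at len x y → Adj G x y

  end : Fin 3 → Fin n
  end i = at i (len i)

next : Fin 3 → Fin 3
next 0F = 1F
next 1F = 2F
next 2F = 0F

next≢ : ∀ i → next i ≢ i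
next≢ 0F ()
next≢ 1F ()
next≢ 2F ()

module _ {n} {G : Graph n} (P : Tripod G) where
  open Tripod P

  Beyond : Fin 3 → ℕ → Fin n → Set
  Beyond i k x = ∃ λ m → k < m × m ≤ len i × x ≡ at i m

  -- A vertex past position `k` is not a root, so its edges are arcs of leg `i`, and the only way
  -- out of this part leads through `at i k`.
  beyond-step : ∀ {i k x y} → Beyond i k x → Adj G x y → Beyond i k y ⊎ y ≡ at i k
  beyond-step (suc m , k<m , m≤ , refl) e with adj⇒edge e
  ... | inj₁ (j , l , l< , x≡ , y≡) with injective m≤ (<⇒≤ l<) x≡
  ...   | refl , inj₁ refl = inj₁ (suc l , m<n⇒m<1+n k<m , l< , y≡)
  beyond-step (suc m , k<m , m≤ , refl) e | inj₂ (inj₁ (j , l , l< , y≡ , x≡))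
    with injective m≤ l< x≡
  ...   | refl , inj₁ refl with m≤n⇒m<n∨m≡n (≤-pred k<m)
  ...     | inj₁ k<l  = inj₁ (l , k<l , <⇒≤ l< , y≡)
  ...     | inj₂ refl = inj₂ y≡
  beyond-step (suc m , k<m , m≤ , refl) e | inj₂ (inj₂ (j , l , x≡ , y≡ , x≢y))
    with injective m≤ z≤n x≡
  ...   | () , _

  -- A vertex `at i k` before the end of its leg is a cut vertex: the walk in `T` from `end i` to
  -- another end starts beyond it and has to pass through it.
  spans : ∀ (T : Subgraph G) → IsTree T → (∀ i → end i ∈ V T) → ∀ x → x ∈ V T
  spans T (conn , _) ends∈ x with cover x
  ... | i , k , k≤ , refl with m≤n⇒m<n∨m≡n k≤
  ...   | inj₂ refl = ends∈ i
  ...   | inj₁ k<   = crosses (len i , k< , ≤-refl , refl) (conn _ _ (ends∈ i) (ends∈ (next i)))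
    where
    crosses : ∀ {u} → Beyond i k u → Walk (E T) u (end (next i)) → at i k ∈ V T
    crosses (m , k<m , m≤ , u≡) here with injective ≤-refl m≤ u≡
    ... | _ , inj₁ eq = contradiction eq (next≢ i)
    ... | refl , inj₂ eq with subst (k <_) eq k<m
    ...   | ()
    crosses b (step {u} {v} e w) with Esub T u v e
    ... | uv , _ , v∈ with beyond-step b uv
    ...   | inj₁ b′ = crosses b′ w
    ...   | inj₂ v≡ = subst (_∈ V T) v≡ v∈

  tripod⇒sdiam : Connected G → Injective _≡_ _≡_ end → SDiam 3 G (n ∸ 1)
  tripod⇒sdiam conn end-inj =
    let S , size , s∈S , S⊆s = image end end-inj
        T₀ , tree₀ , all , count = spanning-tree G conn (end 0F)
    in (S , size , (T₀ , (tree₀ , λ {x} _ → all x) , count) ,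
         λ T (tree , S⊆V) → connected-edgeCount (E T) (λ {x} {y} e → trans (Esym T y x) e) (end 0F)
            λ x → proj₁ tree _ _ (spans T tree (S⊆V ∘ s∈S) _) (spans T tree (S⊆V ∘ s∈S) x)) ,
       -- The spanning tree contains every `S′`, so its size bounds every Steiner distance.
       λ S′ _ m (_ , least) → subst (m ≤_) count (least T₀ (tree₀ , λ {x} _ → all x))

-- Paths and the claw joining three terminals

irreflexive : ∀ {n} (G : Graph n) {x} → ¬ Adj G x x
irreflexive G {x} e with trans (sym e) (irrefl G x)
... | ()

module _ {n} (G : Graph n) where

  -- The path is numbered from `Q` towards `t` and meets `Q` in its first vertex only. Values of
  -- `vertex` past `size` carry no meaning.
  record Path (Q : Fin n → Set) (t : Fin n) : Set where
    field
      size    : ℕ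
      vertex    : ℕ → Fin n
      base      : Q (vertex 0)
      final     : vertex size ≡ t
      steps     : ∀ {k} → k < size → Adj G (vertex k) (vertex (suc k))
      injective : ∀ {k l} → k ≤ size → l ≤ size → vertex k ≡ vertex l → k ≡ l
      fresh     : ∀ {k} → 0 < k → k ≤ size → ¬ Q (vertex k)

  trivial : ∀ {Q t} → Q t → Path Q t
  trivial {t = t} Qt = record
    { size = 0 ; vertex = λ _ → t ; base = Qt ; final = refl ; steps = λ ()
    ; injective = λ { z≤n z≤n _ → refl } ; fresh = λ { () z≤n } }

  truncate : ∀ {Q t} (P : Path Q t) {k} → k ≤ Path.size P → Path Q (Path.vertex P k)
  truncate P {k} k≤ = record
    { size = k ; vertex = vertex ; base = base ; final = refl
    ; steps = λ l< → steps (≤-trans l< k≤)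
    ; injective = λ a b → injective (≤-trans a k≤) (≤-trans b k≤)
    ; fresh = λ a b → fresh a (≤-trans b k≤) }
    where open Path P

  extend : ∀ {Q t u} (P : Path Q t) → Adj G t u → ¬ Q u →
    (∀ {k} → k ≤ Path.size P → Path.vertex P k ≢ u) → Path Q u
  extend {Q} {t} {u} P tu ¬Qu new = record
    { size = suc size ; vertex = vertex′ ; base = subst Q (sym (old z≤n)) base ; final = last
    ; steps = steps′ ; injective = injective′ ; fresh = fresh′ }
    where
    open Path P
    vertex′ : ℕ → Fin n
    vertex′ k = if does (k ≤? size) then vertex k else u
    old : ∀ {k} → k ≤ size → vertex′ k ≡ vertex k
    old {k} k≤ rewrite dec-true (k ≤? size) k≤ = refl
    last : vertex′ (suc size) ≡ u
    last rewrite dec-false (suc size ≤? size) (n≮n size) = refl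
    steps′ : ∀ {k} → k < suc size → Adj G (vertex′ k) (vertex′ (suc k))
    steps′ (s≤s k≤) with m≤n⇒m<n∨m≡n k≤
    ... | inj₁ k<   = subst₂ (Adj G) (sym (old k≤)) (sym (old k<)) (steps k<)
    ... | inj₂ refl = subst₂ (Adj G) (sym (trans (old k≤) final)) (sym last) tu
    injective′ : ∀ {k l} → k ≤ suc size → l ≤ suc size → vertex′ k ≡ vertex′ l → k ≡ l
    injective′ k≤ l≤ eq with m≤n⇒m<n∨m≡n k≤ | m≤n⇒m<n∨m≡n l≤
    ... | inj₁ (s≤s k≤′) | inj₁ (s≤s l≤′) =
          injective k≤′ l≤′ (trans (sym (old k≤′)) (trans eq (old l≤′)))
    ... | inj₁ (s≤s k≤′) | inj₂ refl =
          contradiction (trans (sym (old k≤′)) (trans eq last)) (new k≤′)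
    ... | inj₂ refl | inj₁ (s≤s l≤′) =
          contradiction (trans (sym (old l≤′)) (trans (sym eq) last)) (new l≤′)
    ... | inj₂ refl | inj₂ refl = refl
    fresh′ : ∀ {k} → 0 < k → k ≤ suc size → ¬ Q (vertex′ k)
    fresh′ 0<k k≤ Qk with m≤n⇒m<n∨m≡n k≤
    ... | inj₁ (s≤s k≤′) = fresh 0<k k≤′ (subst Q (old k≤′) Qk)
    ... | inj₂ refl      = ¬Qu (subst Q last Qk)

  -- Loop erasure along the walk: the path found for the rest of the walk is cut at the current
  -- vertex if it passes there and extended to it otherwise, while a vertex in `Q` starts a new
  -- path.
  reach : ∀ {Q : Fin n → Set} → Decidable Q → ∀ {t s} → Walk (adj G) t s → Q s → Path Q t
  reach Q? here Qs = trivial Qs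
  reach Q? (step {u} tv w) Qs with Q? u | reach Q? w Qs
  ... | yes Qu | _ = trivial Qu
  ... | no ¬Qu | P with anyUpTo? (λ k → Path.vertex P k ≟ u) (suc (Path.size P))
  ...   | yes (k , s≤s k≤ , eq) = subst (Path _) eq (truncate P k≤)
  ...   | no new = extend P (Adj-sym G tv) ¬Qu (λ k≤ eq → new (_ , s≤s k≤ , eq))

  -- A subdivided claw ending in the terminals, possibly with empty legs. Further edges of `G`
  -- between its vertices are not excluded at this stage.
  record Legs (s : Fin 3 → Fin n) : Set where
    field
      at        : Fin 3 → ℕ → Fin n
      len       : Fin 3 → ℕ
      common    : ∀ i j → at i 0 ≡ at j 0
      injective : ∀ {i j k l} → k ≤ len i → l ≤ len j → at i k ≡ at j l → k ≡ l × (i ≡ j ⊎ k ≡ 0)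
      steps     : ∀ {i k} → k < len i → Adj G (at i k) (at i (suc k))
      ends      : ∀ i → at i (len i) ≡ s i

  -- Join s₂ to a path between s₁ and s₀ by a path meeting it only once.
  legs : Connected G → ∀ s → Legs s
  legs conn s = record
    { at = at ; len = len ; common = common
    ; injective = injective ; steps = λ {i} → steps i ; ends = ends }
    where
    P = reach (_≟ s 1F) (conn (s 0F) (s 1F)) refl
    module P = Path P
    OnP : Fin n → Set
    OnP x = ∃ λ k → k < suc P.size × P.vertex k ≡ x
    Q = reach {OnP} (λ x → anyUpTo? (λ k → P.vertex k ≟ x) (suc P.size))
          (conn (s 2F) (s 1F)) (0 , s≤s z≤n , P.base)
    module Q = Path Q
    m = proj₁ Q.base
    m≤ : m ≤ P.size
    m≤ = ≤-pred (proj₁ (proj₂ Q.base))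
    foot : P.vertex m ≡ Q.vertex 0
    foot = proj₂ (proj₂ Q.base)
    -- `P` runs from `s 1F` at position 0 up to `s 0F`. The foot of `Q` at position `m` splits it
    -- into an ascending leg and a descending one.
    at : Fin 3 → ℕ → Fin n
    at 0F             k = P.vertex (m + k)
    at 1F       k = P.vertex (m ∸ k)
    at 2F k = Q.vertex k
    len : Fin 3 → ℕ
    len 0F             = P.size ∸ m
    len 1F       = m
    len 2F = Q.size
    base : ∀ i → at i 0 ≡ P.vertex m
    base 0F             = cong P.vertex (+-identityʳ m)
    base 1F       = refl
    base 2F = sym foot
    common : ∀ i j → at i 0 ≡ at j 0
    common i j = trans (base i) (sym (base j))
    up : ∀ {k} → k ≤ P.size ∸ m → m + k ≤ P.size
    up k≤ = ≤-trans (+-monoʳ-≤ m k≤) (≤-reflexive (m+[n∸m]≡n m≤))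
    down : ∀ k → m ∸ k ≤ P.size
    down k = ≤-trans (m∸n≤m m k) m≤
    ∸-injective : ∀ {k l} → k ≤ m → l ≤ m → m ∸ k ≡ m ∸ l → k ≡ l
    ∸-injective k≤ l≤ eq = trans (sym (m∸[m∸n]≡n k≤)) (trans (cong (m ∸_) eq) (m∸[m∸n]≡n l≤))
    up-down : ∀ {k l} → l ≤ m → m + k ≡ m ∸ l → k ≡ 0 × l ≡ 0
    up-down {k} {l} l≤ eq = k≡0 ,
      ∸-injective l≤ z≤n (trans (sym eq) (trans (cong (m +_) k≡0) (+-identityʳ m)))
      where
      k≡0 : k ≡ 0
      k≡0 = +-cancelˡ-≡ m k 0 (trans
        (≤-antisym (≤-trans (≤-reflexive eq) (m∸n≤m m l)) (m≤m+n m k)) (sym (+-identityʳ m)))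
    -- `Q.fresh` keeps all later vertices of `Q` off `P`, so only the foot is shared.
    meet : ∀ {a l} → a ≤ P.size → l ≤ Q.size → P.vertex a ≡ Q.vertex l → a ≡ m × l ≡ 0
    meet {l = zero}  a≤ _  eq = P.injective a≤ m≤ (trans eq (sym foot)) , refl
    meet {l = suc l} a≤ l≤ eq = contradiction (_ , s≤s a≤ , eq) (Q.fresh (s≤s z≤n) l≤)
    meet-up : ∀ {k l} → k ≤ P.size ∸ m → l ≤ Q.size →
      P.vertex (m + k) ≡ Q.vertex l → k ≡ 0 × l ≡ 0
    meet-up {k} k≤ l≤ eq with meet (up k≤) l≤ eq
    ... | a≡m , l≡0 = +-cancelˡ-≡ m k 0 (trans a≡m (sym (+-identityʳ m))) , l≡0
    meet-down : ∀ {k l} → k ≤ m → l ≤ Q.size →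
      P.vertex (m ∸ k) ≡ Q.vertex l → k ≡ 0 × l ≡ 0
    meet-down {k} k≤ l≤ eq with meet (down k) l≤ eq
    ... | a≡m , l≡0 = ∸-injective k≤ z≤n a≡m , l≡0
    at-root : ∀ {i j : Fin 3} {k l} → k ≡ 0 × l ≡ 0 → k ≡ l × (i ≡ j ⊎ k ≡ 0)
    at-root (refl , refl) = refl , inj₂ refl
    injective : ∀ {i j k l} → k ≤ len i → l ≤ len j → at i k ≡ at j l → k ≡ l × (i ≡ j ⊎ k ≡ 0)
    injective {0F} {0F} k≤ l≤ eq = +-cancelˡ-≡ m _ _ (P.injective (up k≤) (up l≤) eq) , inj₁ refl
    injective {0F} {1F} {l = l} k≤ l≤ eq = at-root (up-down l≤ (P.injective (up k≤) (down l) eq))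
    injective {0F} {2F} k≤ l≤ eq = at-root (meet-up k≤ l≤ eq)
    injective {1F} {0F} {k} k≤ l≤ eq =
      at-root (swap (up-down k≤ (P.injective (up l≤) (down k) (sym eq))))
    injective {1F} {1F} {k} {l} k≤ l≤ eq =
      ∸-injective k≤ l≤ (P.injective (down k) (down l) eq) , inj₁ refl
    injective {1F} {2F} k≤ l≤ eq = at-root (meet-down k≤ l≤ eq)
    injective {2F} {0F} k≤ l≤ eq = at-root (swap (meet-up l≤ k≤ (sym eq)))
    injective {2F} {1F} k≤ l≤ eq = at-root (swap (meet-down l≤ k≤ (sym eq)))
    injective {2F} {2F} k≤ l≤ eq = Q.injective k≤ l≤ eq , inj₁ refl
    steps : ∀ i {k} → k < len i → Adj G (at i k) (at i (suc k))
    steps 0F {k} k< = subst (λ a → Adj G (P.vertex (m + k)) (P.vertex a)) (sym (+-suc m k))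
      (P.steps (subst (_≤ P.size) (+-suc m k) (up k<)))
    steps 1F {k} k< = Adj-sym G
      (subst (λ a → Adj G (P.vertex (m ∸ suc k)) (P.vertex a)) (sym (+-∸-assoc 1 k<))
        (P.steps (subst (_≤ P.size) (+-∸-assoc 1 k<) (down k))))
    steps 2F k< = Q.steps k<
    ends : ∀ i → at i (len i) ≡ s i
    ends 0F             = trans (cong P.vertex (m+[n∸m]≡n m≤)) P.final
    ends 1F       = trans (cong P.vertex (n∸n≡0 m)) P.base
    ends 2F = Q.final

-- Further edges between the legs of a claw

SameRoots DistinctRoots : ∀ {n} {G : Graph n} → Tripod G → Set
SameRoots     P = ∀ i j → at i 0 ≡ at j 0 where open Tripod P
DistinctRoots P = ∀ {i j} → at i 0 ≡ at j 0 → i ≡ j where open Tripod P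

third : ∀ {i j : Fin 3} → i ≢ j → ∃ λ t → i ≢ t × j ≢ t × (∀ h → h ≡ i ⊎ h ≡ j ⊎ h ≡ t)
third {0F} {0F} i≢j = contradiction refl i≢j
third {1F} {1F} i≢j = contradiction refl i≢j
third {2F} {2F} i≢j = contradiction refl i≢j
third {0F} {1F} _ = 2F , (λ ()) , (λ ()) ,
  λ { 0F → inj₁ refl ; 1F → inj₂ (inj₁ refl) ; 2F → inj₂ (inj₂ refl) }
third {1F} {0F} _ = 2F , (λ ()) , (λ ()) ,
  λ { 0F → inj₂ (inj₁ refl) ; 1F → inj₁ refl ; 2F → inj₂ (inj₂ refl) }
third {0F} {2F} _ = 1F , (λ ()) , (λ ()) ,
  λ { 0F → inj₁ refl ; 1F → inj₂ (inj₂ refl) ; 2F → inj₂ (inj₁ refl) }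
third {2F} {0F} _ = 1F , (λ ()) , (λ ()) ,
  λ { 0F → inj₂ (inj₁ refl) ; 1F → inj₂ (inj₂ refl) ; 2F → inj₁ refl }
third {1F} {2F} _ = 0F , (λ ()) , (λ ()) ,
  λ { 0F → inj₂ (inj₂ refl) ; 1F → inj₁ refl ; 2F → inj₂ (inj₁ refl) }
third {2F} {1F} _ = 0F , (λ ()) , (λ ()) ,
  λ { 0F → inj₂ (inj₂ refl) ; 1F → inj₂ (inj₁ refl) ; 2F → inj₁ refl }

module _ {n} (G : Graph n) {s : Fin 3 → Fin n} (separating : Separating G s) (L : Legs G s) where
  open Legs L

  centre : Fin n
  centre = at 0F 0

  segment : ∀ {w} i {k l} → k ≤′ l → l ≤ len i →
    (∀ {m} → k ≤ m → m ≤ l → at i m ≢ w) → Star (Deleted G w) (at i k) (at i l)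
  segment i ≤′-refl l≤ avoids = ε
  segment i (≤′-step k≤) l≤ avoids =
    segment i k≤ (<⇒≤ l≤) (λ a b → avoids a (m≤n⇒m≤1+n b)) ◅◅
    ((steps l≤ , avoids (≤′⇒≤ k≤) (n≤1+n _) , avoids (m≤n⇒m≤1+n (≤′⇒≤ k≤)) ≤-refl) ◅ ε)

  arm : ∀ {w} i {l} → l ≤ len i → (∀ {m} → m ≤ l → at i m ≢ w) →
    Star (Deleted G w) centre (at i l)
  arm {w} i {l} l≤ avoids = subst (λ x → Star (Deleted G w) x (at i l)) (common i 0F)
    (segment i (≤⇒≤′ z≤n) l≤ (λ _ → avoids))

  -- Otherwise at i p could be deleted: the part of leg i beyond it stays attached through u.
  no-bypass : ∀ {i p q u} → 0 < p → p < q → q ≤ len i → u ≢ at i p →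
    Star (Deleted G (at i p)) centre u → ¬ Adj G u (at i q)
  no-bypass {i} {p} {q} {u} 0<p p<q q≤ u≢w walk uq = separating centre≢w walks
    where
    p≤ : p ≤ len i
    p≤ = ≤-trans (<⇒≤ p<q) q≤
    centre≢w : centre ≢ at i p
    centre≢w eq with injective z≤n p≤ eq
    ... | refl , _ = contradiction 0<p λ ()
    beyond : ∀ {m} → q ≤ m → m ≤ len i → at i m ≢ at i p
    beyond q≤m m≤ eq = <⇒≱ p<q (≤-trans q≤m (≤-reflexive (proj₁ (injective m≤ p≤ eq))))
    walks : ∀ h → Star (Deleted G (at i p)) centre (s h)
    walks h with h ≟ i
    ... | yes refl = walk ◅◅ ((uq , u≢w , beyond ≤-refl q≤) ◅
          subst (Star (Deleted G (at i p)) (at i q)) (ends i) (segment i (≤⇒≤′ q≤) ≤-refl beyond))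
    ... | no h≢i = subst (Star (Deleted G (at i p)) centre) (ends h) (arm h ≤-refl elsewhere)
      where
      elsewhere : ∀ {m} → m ≤ len h → at h m ≢ at i p
      elsewhere m≤ eq with injective m≤ p≤ eq
      ... | _    , inj₁ h≡i  = h≢i h≡i
      ... | refl , inj₂ refl = contradiction 0<p λ ()

  legs-cover : ∀ x → ∃₂ λ i k → k ≤ len i × at i k ≡ x
  legs-cover x with any? (λ i → anyUpTo? (λ k → at i k ≟ x) (suc (len i)))
  ... | yes (i , k , s≤s k≤ , eq) = i , k , k≤ , eq
  ... | no missed = ⊥-elim (separating (misses z≤n) λ i →
        subst (Star (Deleted G x) centre) (ends i) (arm i ≤-refl misses))
    where
    misses : ∀ {i k} → k ≤ len i → at i k ≢ x
    misses k≤ eq = missed (_ , _ , s≤s k≤ , eq)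

  -- A longer jump would skip `at i (suc k)`, which could then be bypassed from `at i k`, a vertex
  -- still joined to the centre by the start of the leg.
  chord-within : ∀ {i k l} → k < l → l ≤ len i → Adj G (at i k) (at i l) → l ≡ suc k
  chord-within {i} {k} k<l l≤ kl with m≤n⇒m<n∨m≡n k<l
  ... | inj₂ eq = sym eq
  ... | inj₁ k+1<l = ⊥-elim (no-bypass (s≤s z≤n) k+1<l l≤ (before ≤-refl) (arm i k≤ before) kl)
    where
    k≤ : k ≤ len i
    k≤ = ≤-trans (<⇒≤ k<l) l≤
    before : ∀ {m} → m ≤ k → at i m ≢ at i (suc k)
    before m≤k eq with injective (≤-trans m≤k k≤) (≤-trans k<l l≤) eq
    ... | refl , _ = n≮n _ m≤k

  -- If the end on leg `i` lay past position 1, leg `j` and the chord together would bypass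
  -- `at i 1`. The other end is handled by applying this to the reversed edge.
  chord-across : ∀ {i j k l} → i ≢ j → suc k ≤ len i → suc l ≤ len j →
    Adj G (at i (suc k)) (at j (suc l)) → k ≡ 0
  chord-across {k = zero} _ _ _ _ = refl
  chord-across {i} {j} {suc k} {l} i≢j k≤ l≤ kl = ⊥-elim (no-bypass (s≤s z≤n) (s≤s (s≤s z≤n)) k≤
      (elsewhere ≤-refl) (arm j l≤ elsewhere) (Adj-sym G kl))
    where
    elsewhere : ∀ {m} → m ≤ suc l → at j m ≢ at i 1
    elsewhere m≤ eq with injective (≤-trans m≤ l≤) (≤-trans (s≤s z≤n) k≤) eq
    ... | _    , inj₁ j≡i = i≢j (sym j≡i)
    ... | refl , inj₂ ()

  -- The length conditions make `at i 1` and `at j 1` genuine vertices of their legs.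
  Chord : Fin 3 → Fin 3 → Set
  Chord i j = 0 < len i × 0 < len j × Adj G (at i 1) (at j 1)

  Chord? : ∀ i j → Dec (Chord i j)
  Chord? i j = (0 <? len i) ×-dec (0 <? len j) ×-dec (adj G (at i 1) (at j 1) ≟ᵇ true)

  Chord-sym : ∀ {i j} → Chord i j → Chord j i
  Chord-sym (i> , j> , e) = j> , i> , Adj-sym G e

  -- Otherwise the centre could be deleted.
  no-hub : ∀ {j} → 0 < len j → ¬ (∀ h → h ≡ j ⊎ Chord j h)
  no-hub {j} j> hub = separating (off-centre ≤-refl j>) walks
    where
    off-centre : ∀ {i m} → 1 ≤ m → m ≤ len i → at i m ≢ centre
    off-centre 1≤m m≤ eq with injective m≤ z≤n eq
    ... | refl , _ = contradiction 1≤m λ ()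
    outward : ∀ {h} → 0 < len h → Star (Deleted G centre) (at h 1) (s h)
    outward {h} h> = subst (Star (Deleted G centre) (at h 1)) (ends h)
      (segment h (≤⇒≤′ h>) ≤-refl off-centre)
    walks : ∀ h → Star (Deleted G centre) (at j 1) (s h)
    walks h with hub h
    ... | inj₁ refl = outward j>
    ... | inj₂ (_ , h> , e) = (e , off-centre ≤-refl j> , off-centre ≤-refl h>) ◅ outward h>

  same-leg : ∀ {i k l} → k ≤ len i → l ≤ len i → Adj G (at i k) (at i l) →
    Arc at len (at i k) (at i l) ⊎ Arc at len (at i l) (at i k)
  same-leg {i} {k} {l} k≤ l≤ e with <-cmp k l
  ... | tri≈ _ refl _ = contradiction e (irreflexive G)
  ... | tri< k<l _ _ with chord-within k<l l≤ e
  ...   | refl = inj₁ (i , k , l≤ , refl , refl)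
  same-leg {i} {k} {l} k≤ l≤ e | tri> _ _ l<k with chord-within l<k k≤ (Adj-sym G e)
  ...   | refl = inj₂ (i , l , k≤ , refl , refl)

  arc-or-chord : ∀ {x y} → Adj G x y → (Arc at len x y ⊎ Arc at len y x) ⊎
    (∃₂ λ i j → i ≢ j × Chord i j × x ≡ at i 1 × y ≡ at j 1)
  arc-or-chord {x} {y} e with legs-cover x | legs-cover y
  ... | i , k , k≤ , refl | j , l , l≤ , refl with i ≟ j
  ...   | yes refl = inj₁ (same-leg k≤ l≤ e)
  -- The centre lies on every leg, so relabelling it puts both ends of the edge on the same leg.
  arc-or-chord e | i , zero , k≤ , refl | j , l , l≤ , refl | no i≢j
    rewrite common i j = inj₁ (same-leg z≤n l≤ e)
  arc-or-chord e | i , suc k , k≤ , refl | j , zero , l≤ , refl | no i≢j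
    rewrite common j i = inj₁ (same-leg k≤ z≤n e)
  arc-or-chord e | i , suc k , k≤ , refl | j , suc l , l≤ , refl | no i≢j
    with chord-across i≢j k≤ l≤ e | chord-across (i≢j ∘ sym) l≤ k≤ (Adj-sym G e)
  ... | refl | refl = inj₂ (i , j , i≢j , (k≤ , l≤ , e) , refl , refl)

  arc⇒adj : ∀ {x y} → Arc at len x y → Adj G x y
  arc⇒adj (i , k , k< , refl , refl) = steps k<

  spider : (∀ {i j} → i ≢ j → ¬ Chord i j) →
    Σ (Tripod G) λ P → SameRoots P × (∀ i → Tripod.end P i ≡ s i)
  spider no-chord = record
    { at = at ; len = len ; injective = injective ; cover = legs-cover
    ; adj⇒edge = to ; edge⇒adj = from } , common , ends
    where
    to : ∀ {x y} → Adj G x y → Edge at len x y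
    to e with arc-or-chord e
    ... | inj₁ (inj₁ a) = inj₁ a
    ... | inj₁ (inj₂ a) = inj₂ (inj₁ a)
    ... | inj₂ (i , j , i≢j , c , _) = contradiction c (no-chord i≢j)
    from : ∀ {x y} → Edge at len x y → Adj G x y
    from (inj₁ a)        = arc⇒adj a
    from (inj₂ (inj₁ a)) = Adj-sym G (arc⇒adj a)
    from (inj₂ (inj₂ (i , j , refl , refl , x≢y))) = contradiction (common i j) x≢y

  -- The triangle consists of the centre and the first vertices of the legs other than t,
  -- which become the new roots of these legs.
  triangle : ∀ t → (∀ {i} → i ≢ t → 0 < len i) →
    (∀ {i j} → i ≢ t → j ≢ t → i ≢ j → Chord i j) →
    (∀ {i j} → i ≢ j → Chord i j → i ≢ t) → Σ (Tripod G) DistinctRoots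
  triangle t nonempty chord chord≢t = record
    { at = at′ ; len = len′ ; injective = injective′ ; cover = cover′
    ; adj⇒edge = to ; edge⇒adj = from } , distinct
    where
    -- A leg other than `t` starts one vertex later; its former first edge becomes a side of the
    -- triangle.
    shift : Fin 3 → ℕ
    shift h = if does (h ≟ t) then 0 else 1
    shift-cases : ∀ h → (h ≡ t × shift h ≡ 0) ⊎ (h ≢ t × shift h ≡ 1)
    shift-cases h with h ≟ t
    ... | yes h≡t = inj₁ (h≡t , refl)
    ... | no  h≢t = inj₂ (h≢t , refl)
    shift≤ : ∀ h → shift h ≤ len h
    shift≤ h with shift-cases h
    ... | inj₁ (_ , eq)   = subst (_≤ len h) (sym eq) z≤n
    ... | inj₂ (h≢t , eq) = subst (_≤ len h) (sym eq) (nonempty h≢t)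
    at′ : Fin 3 → ℕ → Fin n
    at′ h m = at h (shift h + m)
    len′ : Fin 3 → ℕ
    len′ h = len h ∸ shift h
    valid : ∀ {h m} → m ≤ len′ h → shift h + m ≤ len h
    valid {h} m≤ = ≤-trans (+-monoʳ-≤ (shift h) m≤) (≤-reflexive (m+[n∸m]≡n (shift≤ h)))
    root≢t : ∀ {h} → h ≢ t → at′ h 0 ≡ at h 1
    root≢t {h} h≢t with shift-cases h
    ... | inj₁ (h≡t , _) = contradiction h≡t h≢t
    ... | inj₂ (_ , eq)  = cong (at h) (trans (+-identityʳ _) eq)
    root-t : at′ t 0 ≡ at t 0
    root-t with shift-cases t
    ... | inj₁ (_ , eq)  = cong (at t) (trans (+-identityʳ _) eq)
    ... | inj₂ (t≢t , _) = contradiction refl t≢t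
    injective′ : ∀ {i j k l} → k ≤ len′ i → l ≤ len′ j → at′ i k ≡ at′ j l → k ≡ l × (i ≡ j ⊎ k ≡ 0)
    injective′ {i} {j} {k} {l} k≤ l≤ eq with injective (valid k≤) (valid l≤) eq
    ... | sum≡ , inj₁ refl = +-cancelˡ-≡ (shift i) k l sum≡ , inj₁ refl
    ... | sum≡ , inj₂ eq₀  = trans k≡0 (sym l≡0) , inj₂ k≡0
      where
      k≡0 : k ≡ 0
      k≡0 = m+n≡0⇒n≡0 (shift i) eq₀
      l≡0 : l ≡ 0
      l≡0 = m+n≡0⇒n≡0 (shift j) (trans (sym sum≡) eq₀)
    distinct : ∀ {i j} → at′ i 0 ≡ at′ j 0 → i ≡ j
    distinct {i} {j} eq with injective (valid {i} z≤n) (valid {j} z≤n) eq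
    ... | _    , inj₁ i≡j = i≡j
    -- Coinciding new roots would sit at old position 0, so neither leg is shifted and both are `t`.
    ... | sum≡ , inj₂ eq₀ with shift-cases i | shift-cases j
    ...   | inj₁ (i≡t , _) | inj₁ (j≡t , _) = trans i≡t (sym j≡t)
    ...   | inj₂ (_ , si≡1) | _ = contradiction (trans (sym si≡1) (m+n≡0⇒m≡0 (shift i) eq₀)) λ ()
    ...   | _ | inj₂ (_ , sj≡1) =
            contradiction (trans (sym sj≡1) (m+n≡0⇒m≡0 (shift j) (trans (sym sum≡) eq₀))) λ ()
    below : ∀ {i k} → ¬ shift i ≤ k → i ≢ t × k ≡ 0
    below {i} {k} ¬≤ with shift-cases i
    ... | inj₁ (_ , eq)   = contradiction (subst (_≤ k) (sym eq) z≤n) ¬≤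
    ... | inj₂ (i≢t , eq) = i≢t , n<1⇒n≡0 (subst (k <_) eq (≰⇒> ¬≤))
    cover′ : ∀ x → ∃₂ λ i k → k ≤ len′ i × at′ i k ≡ x
    cover′ x with legs-cover x
    ... | i , k , k≤ , eq with shift i ≤? k
    ...   | yes s≤k = i , k ∸ shift i , ∸-monoˡ-≤ (shift i) k≤ , trans (cong (at i) (m+[n∸m]≡n s≤k)) eq
    ...   | no s≰k with below {i} s≰k
    -- The centre, found as the old root of a shifted leg, is relabelled as the root of `t`.
    ...     | _ , refl = t , 0 , z≤n , trans root-t (trans (common t i) eq)
    -- An old arc lost by the shift joins the centre to a new root. Both orientations are returned
    -- because `to` meets arcs in either direction.
    arc′ : ∀ {x y} → Arc at len x y → Arc at′ len′ x y ⊎ (RootEdge at′ x y × RootEdge at′ y x)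
    arc′ {x} {y} a@(i , k , k< , x≡ , y≡) with shift i ≤? k
    ... | yes s≤k = inj₁ (i , k ∸ shift i , ∸-monoˡ-< k< s≤k ,
            trans x≡ (cong (at i) (sym (m+[n∸m]≡n s≤k))) ,
            trans y≡ (cong (at i) (sym (trans (+-suc _ _) (cong suc (m+[n∸m]≡n s≤k))))))
    ... | no s≰k with below {i} s≰k
    ...   | i≢t , refl = inj₂ ((t , i , x-root , y-root , x≢y) , (i , t , y-root , x-root , x≢y ∘ sym))
      where
      x-root : x ≡ at′ t 0
      x-root = trans x≡ (trans (common i t) (sym root-t))
      y-root : y ≡ at′ i 0
      y-root = trans y≡ (sym (root≢t i≢t))
      x≢y : x ≢ y
      x≢y refl = irreflexive G (arc⇒adj a)
    to : ∀ {x y} → Adj G x y → Edge at′ len′ x y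
    to {x} {y} e with arc-or-chord e
    ... | inj₁ (inj₁ a) with arc′ a
    ...   | inj₁ a′      = inj₁ a′
    ...   | inj₂ (r , _) = inj₂ (inj₂ r)
    to {x} {y} e | inj₁ (inj₂ a) with arc′ a
    ...   | inj₁ a′      = inj₂ (inj₁ a′)
    ...   | inj₂ (_ , r) = inj₂ (inj₂ r)
    to {x} {y} e | inj₂ (i , j , i≢j , c , x≡ , y≡) = inj₂ (inj₂ (i , j ,
      trans x≡ (sym (root≢t (chord≢t i≢j c))) ,
      trans y≡ (sym (root≢t (chord≢t (i≢j ∘ sym) (Chord-sym c)))) ,
      λ { refl → irreflexive G e }))
    from-arc : ∀ {x y} → Arc at′ len′ x y → Adj G x y
    from-arc (i , k , k< , refl , refl) =
      subst (λ m → Adj G (at i (shift i + k)) (at i m)) (sym (+-suc (shift i) k))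
        (steps (subst (_≤ len i) (+-suc (shift i) k) (valid k<)))
    first-step : ∀ {h} → h ≢ t → Adj G (at t 0) (at h 1)
    first-step {h} h≢t = subst (λ x → Adj G x (at h 1)) (common h t) (steps (nonempty h≢t))
    from-root-edge : ∀ i j → at′ i 0 ≢ at′ j 0 → Adj G (at′ i 0) (at′ j 0)
    from-root-edge i j x≢y with i ≟ t | j ≟ t
    ... | yes refl | yes refl = contradiction refl x≢y
    ... | yes refl | no j≢t   = first-step j≢t
    ... | no i≢t   | yes refl = Adj-sym G (first-step i≢t)
    ... | no i≢t   | no j≢t   = proj₂ (proj₂ (chord i≢t j≢t λ { refl → x≢y refl }))
    from : ∀ {x y} → Edge at′ len′ x y → Adj G x y
    from (inj₁ a)        = from-arc a
    from (inj₂ (inj₁ a)) = Adj-sym G (from-arc a)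
    from (inj₂ (inj₂ (i , j , refl , refl , x≢y))) = from-root-edge i j x≢y

  -- A chord at the third leg `t` would end on leg `i` or `j`, and the first vertex of that leg
  -- would be adjacent to those of both other legs, contrary to `no-hub`. So the given chord is the
  -- only one, and `t` keeps the centre as its root.
  one-chord : ∀ {i j} → i ≢ j → Chord i j → Σ (Tripod G) DistinctRoots
  one-chord {i} {j} i≢j c@(i> , j> , _) with third i≢j
  ... | t , i≢t , j≢t , all = triangle t nonempty chord chord≢t
    where
    nonempty : ∀ {h} → h ≢ t → 0 < len h
    nonempty {h} h≢t with all h
    ... | inj₁ refl        = i>
    ... | inj₂ (inj₁ refl) = j>
    ... | inj₂ (inj₂ h≡t)  = contradiction h≡t h≢t
    chord : ∀ {h h′} → h ≢ t → h′ ≢ t → h ≢ h′ → Chord h h′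
    chord {h} {h′} h≢t h′≢t h≢h′ with all h | all h′
    ... | inj₂ (inj₂ h≡t)  | _                 = contradiction h≡t h≢t
    ... | _                | inj₂ (inj₂ h′≡t)  = contradiction h′≡t h′≢t
    ... | inj₁ refl        | inj₁ refl         = contradiction refl h≢h′
    ... | inj₂ (inj₁ refl) | inj₂ (inj₁ refl)  = contradiction refl h≢h′
    ... | inj₁ refl        | inj₂ (inj₁ refl)  = c
    ... | inj₂ (inj₁ refl) | inj₁ refl         = Chord-sym c
    hub : ∀ {a b} → Chord a b → Chord a t → (∀ h → h ≡ a ⊎ h ≡ b ⊎ h ≡ t) → ⊥
    hub {a} ab at all′ = no-hub (proj₁ ab) neighbours
      where
      neighbours : ∀ h → h ≡ a ⊎ Chord a h
      neighbours h with all′ h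
      ... | inj₁ eq          = inj₁ eq
      ... | inj₂ (inj₁ refl) = inj₂ ab
      ... | inj₂ (inj₂ refl) = inj₂ at
    swapped : ∀ h → h ≡ j ⊎ h ≡ i ⊎ h ≡ t
    swapped h with all h
    ... | inj₁ eq        = inj₂ (inj₁ eq)
    ... | inj₂ (inj₁ eq) = inj₁ eq
    ... | inj₂ (inj₂ eq) = inj₂ (inj₂ eq)
    chord≢t : ∀ {h h′} → h ≢ h′ → Chord h h′ → h ≢ t
    chord≢t {h′ = h′} h≢h′ c′ refl with all h′
    ... | inj₁ refl        = hub c (Chord-sym c′) all
    ... | inj₂ (inj₁ refl) = hub (Chord-sym c) (Chord-sym c′) swapped
    ... | inj₂ (inj₂ eq)   = h≢h′ (sym eq)

  -- Distinctness of the ends is passed on in the spider case, where it later rules out two empty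
  -- legs.
  separated⇒tripod : Injective _≡_ _≡_ s →
    (Σ (Tripod G) λ P → SameRoots P × Injective _≡_ _≡_ (Tripod.end P)) ⊎ Σ (Tripod G) DistinctRoots
  separated⇒tripod s-inj with any? (λ i → any? (λ j → ¬? (i ≟ j) ×-dec Chord? i j))
  ... | yes (i , j , i≢j , c) = inj₂ (one-chord i≢j c)
  ... | no none with spider (λ i≢j c → none (_ , _ , i≢j , c))
  ...   | P , same , end≡s = inj₁ (P , same , λ eq → s-inj (trans (sym (end≡s _)) (trans eq (end≡s _))))

-- Isomorphisms

module Transfer {n m} {G : Graph n} {H : Graph m} (P : Tripod G) (Q : Tripod H)
  (len≡ : ∀ i → Tripod.len P i ≡ Tripod.len Q i)
  (roots⇒ : ∀ i j → Tripod.at P i 0 ≡ Tripod.at P j 0 → Tripod.at Q i 0 ≡ Tripod.at Q j 0)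
  (roots⇐ : ∀ i j → Tripod.at Q i 0 ≡ Tripod.at Q j 0 → Tripod.at P i 0 ≡ Tripod.at P j 0)
  where
  private
    module P = Tripod P
    module Q = Tripod Q

  to : Fin n → Fin m
  to x = let i , k , _ = P.cover x in Q.at i k

  -- The label chosen by `P.cover` can differ from the given one only at a root, and then `roots⇒`
  -- identifies the two images.
  to-at : ∀ {i k} → k ≤ P.len i → to (P.at i k) ≡ Q.at i k
  to-at {i} {k} k≤ with P.cover (P.at i k)
  ... | i′ , k′ , k′≤ , eq with P.injective k′≤ k≤ eq
  ...   | refl , inj₁ refl = refl
  ...   | refl , inj₂ refl = roots⇒ i′ i eq

  to-arc : ∀ {x y} → Arc P.at P.len x y → Arc Q.at Q.len (to x) (to y)
  to-arc (i , k , k< , refl , refl) = i , k , subst (k <_) (len≡ i) k< , to-at (<⇒≤ k<) , to-at k<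

  to-edge : ∀ {x y} → Edge P.at P.len x y → Edge Q.at Q.len (to x) (to y)
  to-edge (inj₁ a)        = inj₁ (to-arc a)
  to-edge (inj₂ (inj₁ a)) = inj₂ (inj₁ (to-arc a))
  to-edge (inj₂ (inj₂ (i , j , refl , refl , x≢y))) = inj₂ (inj₂ (i , j , to-at z≤n , to-at z≤n ,
    λ eq → x≢y (roots⇐ i j (trans (sym (to-at z≤n)) (trans eq (to-at z≤n))))))

-- Vertices and edges are described by labels alone, so the lengths and the pattern of coinciding
-- roots determine the graph.
tripod-≅ : ∀ {n m} {G : Graph n} {H : Graph m} (P : Tripod G) (Q : Tripod H) →
  (∀ i → Tripod.len P i ≡ Tripod.len Q i) →
  (∀ i j → Tripod.at P i 0 ≡ Tripod.at P j 0 → Tripod.at Q i 0 ≡ Tripod.at Q j 0) →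
  (∀ i j → Tripod.at Q i 0 ≡ Tripod.at Q j 0 → Tripod.at P i 0 ≡ Tripod.at P j 0) →
  G ≅ H
tripod-≅ {G = G} {H} P Q len≡ roots⇒ roots⇐ =
  mk↔ₛ′ PQ.to QP.to to-from from-to ,
  λ x y → bool-≡ (Q.edge⇒adj ∘ PQ.to-edge ∘ P.adj⇒edge)
    (subst₂ (Adj G) (from-to x) (from-to y) ∘ P.edge⇒adj ∘ QP.to-edge ∘ Q.adj⇒edge)
  where
  module P = Tripod P
  module Q = Tripod Q
  module PQ = Transfer P Q len≡ roots⇒ roots⇐
  module QP = Transfer Q P (sym ∘ len≡) roots⇐ roots⇒
  to-from : ∀ y → PQ.to (QP.to y) ≡ y
  to-from y with Q.cover y
  ... | i , k , k≤ , eq = trans (PQ.to-at (subst (k ≤_) (sym (len≡ i)) k≤)) eq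
  from-to : ∀ x → QP.to (PQ.to x) ≡ x
  from-to x with P.cover x
  ... | i , k , k≤ , eq = trans (QP.to-at (subst (k ≤_) (len≡ i) k≤)) eq

to-injective : ∀ {A B : Set} (f : A ↔ B) → Injective _≡_ _≡_ (Inverse.to f)
to-injective f = Injection.injective (↔⇒↣ f)

from-injective : ∀ {A B : Set} (f : A ↔ B) → Injective _≡_ _≡_ (Inverse.from f)
from-injective f = to-injective (↔-sym f)

-- For the converse: the Steiner diameter is then computed in `G` itself rather than transported
-- along the isomorphism.
pullback : ∀ {n m} {G : Graph n} {H : Graph m} → G ≅ H → Tripod H → Tripod G
pullback {G = G} {H} (f , f-adj) P = record
  { at = λ i k → from (at i k)
  ; len = len
  ; injective = λ k≤ l≤ eq → injective k≤ l≤ (from-injective f eq)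
  ; cover = λ x → let i , k , k≤ , eq = cover (to x) in i , k , k≤ , trans (cong from eq) (from-to x)
  ; adj⇒edge = λ {x} {y} e → edge⇐ (adj⇒edge (trans (sym (f-adj x y)) e))
  ; edge⇒adj = λ {x} {y} e → trans (f-adj x y) (edge⇒adj (edge⇒ e)) }
  where
  open Tripod P
  open Inverse f using (to; from)
  to-from : ∀ y → to (from y) ≡ y
  to-from = Inverse.strictlyInverseˡ f
  from-to : ∀ x → from (to x) ≡ x
  from-to = Inverse.strictlyInverseʳ f
  to⇒from : ∀ {x y} → to x ≡ y → x ≡ from y
  to⇒from {x} eq = trans (sym (from-to x)) (cong from eq)
  from⇒to : ∀ {x y} → x ≡ from y → to x ≡ y
  from⇒to {x} {y} eq = trans (cong to eq) (to-from y)
  at′ : Fin 3 → ℕ → Fin _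
  at′ i k = from (at i k)
  edge⇐ : ∀ {x y} → Edge at len (to x) (to y) → Edge at′ len x y
  edge⇐ (inj₁ (i , k , k< , x≡ , y≡)) = inj₁ (i , k , k< , to⇒from x≡ , to⇒from y≡)
  edge⇐ (inj₂ (inj₁ (i , k , k< , y≡ , x≡))) = inj₂ (inj₁ (i , k , k< , to⇒from y≡ , to⇒from x≡))
  edge⇐ (inj₂ (inj₂ (i , j , x≡ , y≡ , x≢y))) = inj₂ (inj₂ (i , j , to⇒from x≡ , to⇒from y≡ , x≢y ∘ cong to))
  edge⇒ : ∀ {x y} → Edge at′ len x y → Edge at len (to x) (to y)
  edge⇒ (inj₁ (i , k , k< , x≡ , y≡)) = inj₁ (i , k , k< , from⇒to x≡ , from⇒to y≡)
  edge⇒ (inj₂ (inj₁ (i , k , k< , y≡ , x≡))) = inj₂ (inj₁ (i , k , k< , from⇒to y≡ , from⇒to x≡))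
  edge⇒ (inj₂ (inj₂ (i , j , x≡ , y≡ , x≢y))) = inj₂ (inj₂ (i , j , from⇒to x≡ , from⇒to y≡ ,
    λ eq → x≢y (trans (sym (from-to _)) (trans (cong from eq) (from-to _)))))

-- The construction yields the legs in no particular order, whereas the two families list
-- nondecreasing lengths.
permute : ∀ {n} {G : Graph n} → Permutation′ 3 → Tripod G → Tripod G
permute {G = G} σ P = record
  { at = at′
  ; len = len′
  ; injective = λ k≤ l≤ eq → map₂ (map₁ (to-injective σ)) (injective k≤ l≤ eq)
  ; cover = cover′
  ; adj⇒edge = edge⇒ ∘ adj⇒edge
  ; edge⇒adj = edge⇒adj ∘ edge⇐ }
  where
  open Tripod P
  at′ : Fin 3 → ℕ → Fin _
  at′ i = at (σ ⟨$⟩ʳ i)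
  len′ : Fin 3 → ℕ
  len′ i = len (σ ⟨$⟩ʳ i)
  cover′ : ∀ x → ∃₂ λ i k → k ≤ len′ i × at′ i k ≡ x
  cover′ x with cover x
  ... | i , k , k≤ , eq = σ ⟨$⟩ˡ i , k , subst (λ j → k ≤ len j) (sym (inverseʳ σ)) k≤ ,
        trans (cong (λ j → at j k) (inverseʳ σ)) eq
  arc⇒ : ∀ {x y} → Arc at len x y → Arc at′ len′ x y
  arc⇒ (i , k , k< , x≡ , y≡) = σ ⟨$⟩ˡ i , k , subst (λ j → k < len j) (sym (inverseʳ σ)) k< ,
    trans x≡ (cong (λ j → at j k) (sym (inverseʳ σ))) ,
    trans y≡ (cong (λ j → at j (suc k)) (sym (inverseʳ σ)))
  edge⇒ : ∀ {x y} → Edge at len x y → Edge at′ len′ x y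
  edge⇒ (inj₁ a)        = inj₁ (arc⇒ a)
  edge⇒ (inj₂ (inj₁ a)) = inj₂ (inj₁ (arc⇒ a))
  edge⇒ (inj₂ (inj₂ (i , j , x≡ , y≡ , x≢y))) = inj₂ (inj₂ (σ ⟨$⟩ˡ i , σ ⟨$⟩ˡ j ,
    trans x≡ (cong (λ j → at j 0) (sym (inverseʳ σ))) ,
    trans y≡ (cong (λ j → at j 0) (sym (inverseʳ σ))) , x≢y))
  edge⇐ : ∀ {x y} → Edge at′ len′ x y → Edge at len x y
  edge⇐ (inj₁ (i , a))               = inj₁ (_ , a)
  edge⇐ (inj₂ (inj₁ (i , a)))        = inj₂ (inj₁ (_ , a))
  edge⇐ (inj₂ (inj₂ (i , j , r))) = inj₂ (inj₂ (_ , _ , r))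

sorting : (l : Fin 3 → ℕ) → ∃ λ (σ : Permutation′ 3) →
  l (σ ⟨$⟩ʳ 0F) ≤ l (σ ⟨$⟩ʳ 1F) × l (σ ⟨$⟩ʳ 1F) ≤ l (σ ⟨$⟩ʳ 2F)
sorting l with ≤-total (l 0F) (l 1F) | ≤-total (l 1F) (l 2F) | ≤-total (l 0F) (l 2F)
... | inj₁ 0≤1 | inj₁ 1≤2 | _        = idₚ , 0≤1 , 1≤2
... | inj₁ 0≤1 | inj₂ 2≤1 | inj₁ 0≤2 = transpose 1F 2F , 0≤2 , 2≤1
... | inj₁ 0≤1 | inj₂ 2≤1 | inj₂ 2≤0 = transpose 0F 1F ∘ₚ transpose 1F 2F , 2≤0 , 0≤1
... | inj₂ 1≤0 | inj₁ 1≤2 | inj₁ 0≤2 = transpose 0F 1F , 1≤0 , 0≤2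
... | inj₂ 1≤0 | inj₁ 1≤2 | inj₂ 2≤0 = transpose 1F 2F ∘ₚ transpose 0F 1F , 1≤2 , 2≤0
... | inj₂ 1≤0 | inj₂ 2≤1 | _        = transpose 0F 2F , 2≤1 , 1≤0

-- Boolean tests and the numbered models of the two families

∧-true⁻ : ∀ a {b} → a ∧ b ≡ true → a ≡ true × b ≡ true
∧-true⁻ true eq = refl , eq

∧-true⁺ : ∀ {a b} → a ≡ true → b ≡ true → a ∧ b ≡ true
∧-true⁺ refl refl = refl

≡ᵇ-true⁻ : ∀ {x y} → (x ≡ᵇ y) ≡ true → x ≡ y
≡ᵇ-true⁻ eq = ≡ᵇ⇒≡ _ _ (≡true⇒T eq)

≡ᵇ-true⁺ : ∀ {x y} → x ≡ y → (x ≡ᵇ y) ≡ true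
≡ᵇ-true⁺ eq = T⇒≡true (≡⇒≡ᵇ _ _ eq)

≢ᵇ-true⁻ : ∀ {x y} → not (x ≡ᵇ y) ≡ true → x ≢ y
≢ᵇ-true⁻ {x} eq refl rewrite eqb-refl x = case eq of λ ()

≢ᵇ-true⁺ : ∀ {x y} → x ≢ y → not (x ≡ᵇ y) ≡ true
≢ᵇ-true⁺ {x} {y} x≢y with x ≡ᵇ y in eq
... | true  = contradiction (≡ᵇ-true⁻ eq) x≢y
... | false = refl

<ᵇ-true⁻ : ∀ {x y} → (x <ᵇ y) ≡ true → x < y
<ᵇ-true⁻ eq = <ᵇ⇒< _ _ (≡true⇒T eq)

<ᵇ-true⁺ : ∀ {x y} → x < y → (x <ᵇ y) ≡ true
<ᵇ-true⁺ x<y = T⇒≡true (<⇒<ᵇ x<y)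

-- The vertex numbering common to Spider and TriGraph: core roots first, then the
-- three paths consecutively.

module Layout (core : ℕ) (root : Fin 3 → ℕ) (root< : ∀ i → root i < core)
  (core-roots : ∀ {x} → x < core → ∃ λ i → root i ≡ x) (a b c : ℕ) where

  size : Fin 3 → ℕ
  size 0F = a
  size 1F = b
  size 2F = c

  offset : Fin 3 → ℕ
  offset 0F = 0
  offset 1F = a
  offset 2F = a + b

  pos : Fin 3 → ℕ → ℕ
  pos i zero    = root i
  pos i (suc k) = core + (offset i + k)

  offset-mono : ∀ {i j} → toℕ i < toℕ j → offset i + size i ≤ offset j
  offset-mono {0F} {1F} _ = ≤-refl
  offset-mono {0F} {2F} _ = m≤m+n a b
  offset-mono {1F} {2F} _ = ≤-refl
  offset-mono {1F} {1F} (s≤s ())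
  offset-mono {2F} {1F} (s≤s ())
  offset-mono {2F} {2F} (s≤s (s≤s ()))

  offset-total : ∀ i → offset i + size i ≤ a + b + c
  offset-total 0F = ≤-trans (m≤m+n a b) (m≤m+n (a + b) c)
  offset-total 1F = m≤m+n (a + b) c
  offset-total 2F = ≤-refl

  separate : ∀ {i j k l} → toℕ i < toℕ j → k < size i → offset i + k < offset j + l
  separate {i} {j} {k} {l} i<j k< = <-≤-trans (+-monoʳ-< (offset i) k<)
    (≤-trans (offset-mono i<j) (m≤m+n (offset j) l))

  offset-injective : ∀ {i j k l} → k < size i → l < size j →
    offset i + k ≡ offset j + l → k ≡ l × i ≡ j
  offset-injective {i} {j} {k} {l} k< l< eq with <-cmp (toℕ i) (toℕ j)
  ... | tri< i<j _ _ = contradiction eq (<⇒≢ (separate i<j k<))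
  ... | tri> _ _ j<i = contradiction (sym eq) (<⇒≢ (separate j<i l<))
  ... | tri≈ _ i≡j _ with toℕ-injective i≡j
  ...   | refl = +-cancelˡ-≡ (offset i) k l eq , refl

  pos-injective : ∀ {i j k l} → k ≤ size i → l ≤ size j → pos i k ≡ pos j l → k ≡ l × (i ≡ j ⊎ k ≡ 0)
  pos-injective {k = zero} {zero} _ _ _ = refl , inj₂ refl
  pos-injective {i} {k = zero} {suc l} _ _ eq = contradiction eq (<⇒≢ (<-≤-trans (root< i) (m≤m+n core _)))
  pos-injective {j = j} {suc k} {zero} _ _ eq = contradiction (sym eq) (<⇒≢ (<-≤-trans (root< j) (m≤m+n core _)))
  pos-injective {k = suc k} {suc l} k≤ l≤ eq with offset-injective k≤ l≤ (+-cancelˡ-≡ core _ _ eq)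
  ... | refl , i≡j = refl , inj₁ i≡j

  pos< : ∀ {i k} → k ≤ size i → pos i k < core + (a + b + c)
  pos< {i} {zero}  _  = <-≤-trans (root< i) (m≤m+n core _)
  pos< {i} {suc k} k< = +-monoʳ-< core (<-≤-trans (+-monoʳ-< (offset i) k<) (offset-total i))

  locate : ∀ {z} → z < a + b + c → ∃₂ λ i k → k < size i × offset i + k ≡ z
  locate {z} z< with z <? a
  ... | yes z<a = 0F , z , z<a , refl
  ... | no z≮a with z <? a + b
  ...   | yes z<a+b = 1F , z ∸ a , +-cancelˡ-< a _ _ (subst (_< a + b) (sym (m+[n∸m]≡n (≮⇒≥ z≮a))) z<a+b) ,
          m+[n∸m]≡n (≮⇒≥ z≮a)
  ...   | no z≮a+b = 2F , z ∸ (a + b) ,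
          +-cancelˡ-< (a + b) _ _ (subst (_< a + b + c) (sym (m+[n∸m]≡n (≮⇒≥ z≮a+b))) z<) ,
          m+[n∸m]≡n (≮⇒≥ z≮a+b)

  pos-cover : ∀ {x} → x < core + (a + b + c) → ∃₂ λ i k → k ≤ size i × pos i k ≡ x
  pos-cover {x} x< with x <? core
  ... | yes x<core = let i , eq = core-roots x<core in i , 0 , z≤n , eq
  ... | no  x≮core with locate (+-cancelˡ-< core _ _ (subst (_< core + (a + b + c)) (sym (m+[n∸m]≡n (≮⇒≥ x≮core))) x<))
  ...   | i , k , k< , eq = i , suc k , k< , trans (cong (core +_) eq) (m+[n∸m]≡n (≮⇒≥ x≮core))

  PosArc : ℕ → ℕ → Set
  PosArc x y = ∃₂ λ i k → k < size i × x ≡ pos i k × y ≡ pos i (suc k)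

  -- Counted from the end of the core, `z` is the last vertex of a path exactly when `suc z` is `a`,
  -- `a + b` or `a + b + c`; the first two are excluded explicitly and the third by the bound.
  successor-arc : ∀ {z} → suc z < a + b + c → suc z ≢ a → suc z ≢ a + b →
    PosArc (core + z) (suc (core + z))
  successor-arc {z} z< z≢a z≢a+b with locate (<⇒≤ z<)
  ... | i , k , k< , refl = i , suc k , ≤∧≢⇒< k< (not-last i z< z≢a z≢a+b) , refl ,
        trans (sym (+-suc core _)) (cong (core +_) (sym (+-suc (offset i) k)))
    where
    not-last : ∀ i → suc (offset i + k) < a + b + c → suc (offset i + k) ≢ a →
      suc (offset i + k) ≢ a + b → suc k ≢ size i
    not-last 0F _ ≢a _ refl = ≢a refl
    not-last 1F _ _ ≢a+b refl = ≢a+b (sym (+-suc a k))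
    not-last 2F lt _ _ refl = <⇒≢ lt (sym (+-suc (a + b) k))

  inner-arc : ∀ i {k} → suc k < size i → suc (offset i + k) ≢ a × suc (offset i + k) ≢ a + b
  inner-arc 0F k< = <⇒≢ k< , <⇒≢ (<-≤-trans k< (m≤m+n a b))
  inner-arc 1F {k} k< = (λ eq → <⇒≢ (s≤s (m≤m+n a k)) (sym eq)) ,
    λ eq → <⇒≢ (+-monoʳ-< a k<) (trans (+-suc a k) eq)
  inner-arc 2F {k} k< = (λ eq → <⇒≢ (s≤s (≤-trans (m≤m+n a b) (m≤m+n (a + b) k))) (sym eq)) ,
    λ eq → <⇒≢ (s≤s (m≤m+n (a + b) k)) (sym eq)

  -- `rel` has to list arcs pointing away from the roots, while `root⁺` accepts either direction,
  -- since `fromRel` symmetrises.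
  module _ {N} (N≡ : N ≡ core + (a + b + c)) (rel : ℕ → ℕ → Bool)
    (rel⁻ : ∀ {x y} → y < core + (a + b + c) → rel x y ≡ true →
      PosArc x y ⊎ ∃₂ λ i j → x ≡ root i × y ≡ root j)
    (arc⁺ : ∀ {x y} → PosArc x y → rel x y ≡ true)
    (root⁺ : ∀ i j → root i ≢ root j → rel (root i) (root j) ∨ rel (root j) (root i) ≡ true)
    where

    H : Graph N
    H = fromRel (λ i j → rel (toℕ i) (toℕ j))

    below : ∀ {x} → x < core + (a + b + c) → x < N
    below {x} = subst (x <_) (sym N≡)

    at : Fin 3 → ℕ → Fin N
    at i k with pos i k <? N
    ... | yes p = fromℕ< p
    -- A default for positions outside the numbering; it does not occur for `k ≤ size i`.
    ... | no  _ = fromℕ< (below (pos< {i} z≤n))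

    toℕ-at : ∀ {i k} → k ≤ size i → toℕ (at i k) ≡ pos i k
    toℕ-at {i} {k} k≤ with pos i k <? N
    ... | yes p = toℕ-fromℕ< p
    ... | no ¬p = contradiction (below (pos< k≤)) ¬p

    at-≡ : ∀ {i k x} → k ≤ size i → toℕ x ≡ pos i k → x ≡ at i k
    at-≡ k≤ eq = toℕ-injective (trans eq (sym (toℕ-at k≤)))

    layout-injective : ∀ {i j k l} → k ≤ size i → l ≤ size j → at i k ≡ at j l → k ≡ l × (i ≡ j ⊎ k ≡ 0)
    layout-injective k≤ l≤ eq = pos-injective k≤ l≤ (trans (sym (toℕ-at k≤)) (trans (cong toℕ eq) (toℕ-at l≤)))

    rel⇒edge : ∀ {x y} → x ≢ y → rel (toℕ x) (toℕ y) ≡ true → Arc at size x y ⊎ RootEdge at x y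
    rel⇒edge {x} {y} x≢y r with rel⁻ (subst (toℕ y <_) N≡ (toℕ<n y)) r
    ... | inj₁ (i , k , k< , x≡ , y≡) = inj₁ (i , k , k< , at-≡ (<⇒≤ k<) x≡ , at-≡ k< y≡)
    ... | inj₂ (i , j , x≡ , y≡)      = inj₂ (i , j , at-≡ z≤n x≡ , at-≡ z≤n y≡ , x≢y)

    adj⇒edge : ∀ {x y} → Adj H x y → Edge at size x y
    adj⇒edge {x} {y} e with ∧-true⁻ (rel (toℕ x) (toℕ y) ∨ rel (toℕ y) (toℕ x)) e
    ... | r , x≢ᵇy with ∨-true⁻ (rel (toℕ x) (toℕ y)) r | ≢ᵇ-true⁻ x≢ᵇy ∘ cong toℕ
    ...   | inj₁ xy | x≢y with rel⇒edge x≢y xy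
    ...     | inj₁ arc = inj₁ arc
    ...     | inj₂ re  = inj₂ (inj₂ re)
    adj⇒edge {x} {y} e | r , x≢ᵇy | inj₂ yx | x≢y with rel⇒edge (x≢y ∘ sym) yx
    ...     | inj₁ arc = inj₂ (inj₁ arc)
    ...     | inj₂ (i , j , y≡ , x≡ , y≢x) = inj₂ (inj₂ (j , i , x≡ , y≡ , x≢y))

    layout-arc⇒adj : ∀ {x y} → Arc at size x y → Adj H x y
    layout-arc⇒adj {x} {y} (i , k , k< , x≡ , y≡) = ∧-true⁺
      (∨-trueˡ (arc⁺ (i , k , k< , trans (cong toℕ x≡) (toℕ-at (<⇒≤ k<)) , trans (cong toℕ y≡) (toℕ-at k<))))
      (≢ᵇ-true⁺ λ eq → 1+n≢n (sym (proj₁ (layout-injective {i} {i} (<⇒≤ k<) k<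
        (trans (sym x≡) (trans (toℕ-injective eq) y≡))))))

    edge⇒adj : ∀ {x y} → Edge at size x y → Adj H x y
    edge⇒adj (inj₁ arc)        = layout-arc⇒adj arc
    edge⇒adj (inj₂ (inj₁ arc)) = Adj-sym H (layout-arc⇒adj arc)
    edge⇒adj {x} {y} (inj₂ (inj₂ (i , j , x≡ , y≡ , x≢y))) = ∧-true⁺
      (subst₂ (λ u v → rel u v ∨ rel v u ≡ true) (sym x≡′) (sym y≡′)
        (root⁺ i j λ eq → x≢y (toℕ-injective (trans x≡′ (trans eq (sym y≡′))))))
      (≢ᵇ-true⁺ (x≢y ∘ toℕ-injective))
      where
      x≡′ : toℕ x ≡ root i
      x≡′ = trans (cong toℕ x≡) (toℕ-at z≤n)
      y≡′ : toℕ y ≡ root j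
      y≡′ = trans (cong toℕ y≡) (toℕ-at z≤n)

    tripod : Tripod H
    tripod = record
      { at = at ; len = size ; injective = layout-injective
      ; cover = λ x → let i , k , k≤ , eq = pos-cover (subst (toℕ x <_) N≡ (toℕ<n x)) in
                      i , k , k≤ , sym (at-≡ k≤ (sym eq))
      ; adj⇒edge = adj⇒edge ; edge⇒adj = edge⇒adj }

    root-≡ : ∀ {i j} → at i 0 ≡ at j 0 → root i ≡ root j
    root-≡ eq = trans (sym (toℕ-at z≤n)) (trans (cong toℕ eq) (toℕ-at z≤n))

    ≡-root : ∀ {i j} → root i ≡ root j → at i 0 ≡ at j 0
    ≡-root eq = at-≡ z≤n (trans (toℕ-at z≤n) eq)

module SpiderLayout (a b c : ℕ) where

  core-roots : ∀ {x} → x < 1 → ∃ λ (i : Fin 3) → 0 ≡ x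
  core-roots x<1 = 0F , sym (n<1⇒n≡0 x<1)

  open Layout 1 (λ _ → 0) (λ _ → s≤s z≤n) core-roots a b c public

  rel⁻ : ∀ {x y} → y < 1 + (a + b + c) → spiderRel a b c x y ≡ true →
    PosArc x y ⊎ ∃₂ λ (i j : Fin 3) → x ≡ 0 × y ≡ 0
  rel⁻ {x} {y} y< r with ∨-true⁻ ((y ≡ᵇ suc x) ∧ not (x ≡ᵇ 0) ∧ not (x ≡ᵇ a) ∧ not (x ≡ᵇ (a + b))) r
  rel⁻ {zero} {y} y< r | inj₁ e with proj₂ (∧-true⁻ (y ≡ᵇ 1) e)
  ... | ()
  rel⁻ {suc z} {y} y< r | inj₁ e with ∧-true⁻ (y ≡ᵇ suc (suc z)) e
  ... | y≡ , e′ with ∧-true⁻ (not (suc z ≡ᵇ a)) e′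
  ...   | ≢a , ≢a+b with ≡ᵇ-true⁻ {y} {suc (suc z)} y≡
  ...     | refl = inj₁ (successor-arc (≤-pred y<) (≢ᵇ-true⁻ ≢a) (≢ᵇ-true⁻ ≢a+b))
  rel⁻ {zero} {y} y< r | inj₂ e with ∨-true⁻ ((0 <ᵇ a) ∧ (y ≡ᵇ 1)) e
  ... | inj₁ e₀ = let 0<a , y≡ = ∧-true⁻ (0 <ᵇ a) e₀ in
        inj₁ (0F , 0 , <ᵇ-true⁻ 0<a , refl , ≡ᵇ-true⁻ y≡)
  ... | inj₂ e′ with ∨-true⁻ ((0 <ᵇ b) ∧ (y ≡ᵇ suc a)) e′
  ...   | inj₁ e₁ = let 0<b , y≡ = ∧-true⁻ (0 <ᵇ b) e₁ in
          inj₁ (1F , 0 , <ᵇ-true⁻ 0<b , refl , trans (≡ᵇ-true⁻ {y} y≡) (cong suc (sym (+-identityʳ a))))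
  ...   | inj₂ e₂ = let 0<c , y≡ = ∧-true⁻ (0 <ᵇ c) e₂ in
          inj₁ (2F , 0 , <ᵇ-true⁻ 0<c , refl , trans (≡ᵇ-true⁻ {y} y≡) (cong suc (sym (+-identityʳ (a + b)))))

  arc⁺ : ∀ {x y} → PosArc x y → spiderRel a b c x y ≡ true
  arc⁺ {y = y} (0F , zero , 0< , refl , y≡) =
    ∨-trueʳ ((y ≡ᵇ 1) ∧ false)
      (∨-trueˡ {(0 <ᵇ a) ∧ (y ≡ᵇ 1)} (∧-true⁺ (<ᵇ-true⁺ 0<) (≡ᵇ-true⁺ y≡)))
  arc⁺ {y = y} (1F , zero , 0< , refl , y≡) =
    ∨-trueʳ ((y ≡ᵇ 1) ∧ false) (∨-trueʳ ((0 <ᵇ a) ∧ (y ≡ᵇ 1))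
      (∨-trueˡ (∧-true⁺ (<ᵇ-true⁺ 0<) (≡ᵇ-true⁺ {y} (trans y≡ (cong suc (+-identityʳ a)))))))
  arc⁺ {y = y} (2F , zero , 0< , refl , y≡) =
    ∨-trueʳ ((y ≡ᵇ 1) ∧ false) (∨-trueʳ ((0 <ᵇ a) ∧ (y ≡ᵇ 1)) (∨-trueʳ ((0 <ᵇ b) ∧ (y ≡ᵇ suc a))
      (∧-true⁺ (<ᵇ-true⁺ 0<) (≡ᵇ-true⁺ {y} (trans y≡ (cong suc (+-identityʳ (a + b))))))))
  arc⁺ (i , suc k , k< , refl , refl) = let ≢a , ≢a+b = inner-arc i k< in
    ∨-trueˡ (∧-true⁺ (≡ᵇ-true⁺ (+-suc (offset i) k)) (∧-true⁺ (≢ᵇ-true⁺ ≢a) (≢ᵇ-true⁺ ≢a+b)))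

  N≡ : a + b + c + 1 ≡ 1 + (a + b + c)
  N≡ = +-comm (a + b + c) 1

  root⁺ : (i j : Fin 3) → 0 ≢ 0 → spiderRel a b c 0 0 ∨ spiderRel a b c 0 0 ≡ true
  root⁺ _ _ 0≢0 = contradiction refl 0≢0

  spider-tripod : Tripod (Spider a b c)
  spider-tripod = tripod N≡ (spiderRel a b c) rel⁻ arc⁺ root⁺

  spider-roots : SameRoots spider-tripod
  spider-roots i j = ≡-root N≡ (spiderRel a b c) rel⁻ arc⁺ root⁺ {i} {j} refl

module TriLayout (p q r : ℕ) where

  core-roots : ∀ {x} → x < 3 → ∃ λ (i : Fin 3) → toℕ i ≡ x
  core-roots x<3 = fromℕ< x<3 , toℕ-fromℕ< x<3

  open Layout 3 toℕ toℕ<n core-roots p q r public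

  PosEdge : ℕ → ℕ → Set
  PosEdge x y = PosArc x y ⊎ ∃₂ λ (i j : Fin 3) → x ≡ toℕ i × y ≡ toℕ j

  edge-to : ∀ x y x′ y′ → PosEdge x′ y′ → (x ≡ᵇ x′) ∧ (y ≡ᵇ y′) ≡ true → PosEdge x y
  edge-to x y x′ y′ P e = let x≡ , y≡ = ∧-true⁻ (x ≡ᵇ x′) e in
    subst₂ PosEdge (sym (≡ᵇ-true⁻ {x} x≡)) (sym (≡ᵇ-true⁻ {y} y≡)) P

  attach : ∀ i {x y m} → m ≡ 3 + (offset i + 0) →
    (0 <ᵇ size i) ∧ (x ≡ᵇ toℕ i) ∧ (y ≡ᵇ m) ≡ true → PosEdge x y
  attach i {x} {y} m≡ e with ∧-true⁻ (0 <ᵇ size i) e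
  ... | 0< , e′ with ∧-true⁻ (x ≡ᵇ toℕ i) e′
  ...   | x≡ , y≡ = inj₁ (i , 0 , <ᵇ-true⁻ 0< , ≡ᵇ-true⁻ x≡ , trans (≡ᵇ-true⁻ {y} y≡) m≡)

  first-position : ∀ m → m + 3 ≡ 3 + (m + 0)
  first-position m = trans (+-comm m 3) (cong (3 +_) (sym (+-identityʳ m)))

  rel⁻ : ∀ {x y} → y < 3 + (p + q + r) → triRel p q r x y ≡ true → PosEdge x y
  rel⁻ {x} {y} y< e with ∨-true⁻ ((x ≡ᵇ 0) ∧ (y ≡ᵇ 1)) e
  ... | inj₁ e₁ = edge-to x y 0 1 (inj₂ (0F , 1F , refl , refl)) e₁
  ... | inj₂ e with ∨-true⁻ ((x ≡ᵇ 1) ∧ (y ≡ᵇ 2)) e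
  ... | inj₁ e₂ = edge-to x y 1 2 (inj₂ (1F , 2F , refl , refl)) e₂
  ... | inj₂ e with ∨-true⁻ ((x ≡ᵇ 0) ∧ (y ≡ᵇ 2)) e
  ... | inj₁ e₃ = edge-to x y 0 2 (inj₂ (0F , 2F , refl , refl)) e₃
  ... | inj₂ e with ∨-true⁻ ((y ≡ᵇ suc x) ∧ (2 <ᵇ x) ∧ not (x ≡ᵇ (p + 2)) ∧ not (x ≡ᵇ (p + q + 2))) e
  rel⁻ {x} {y} y< _ | inj₂ _ | inj₂ _ | inj₂ _ | inj₁ e with ∧-true⁻ (y ≡ᵇ suc x) e
  ... | y≡ , e′ with ∧-true⁻ (2 <ᵇ x) e′
  ...   | 2< , e″ with ∧-true⁻ (not (x ≡ᵇ (p + 2))) e″ | <ᵇ-true⁻ {2} {x} 2< | ≡ᵇ-true⁻ {y} y≡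
  -- The test `2 <ᵇ x` writes `x` as `3 + z`, so the excluded value `p + 2` means that `suc z` is
  -- `p`, and likewise for `p + q + 2`.
  ...     | ≢p , ≢p+q | s≤s (s≤s (s≤s {n = z} _)) | refl =
            inj₁ (successor-arc (+-cancelˡ-< 3 _ _ y<)
              (λ eq → ≢ᵇ-true⁻ ≢p (trans (cong (2 +_) eq) (+-comm 2 p)))
              (λ eq → ≢ᵇ-true⁻ ≢p+q (trans (cong (2 +_) eq) (+-comm 2 (p + q)))))
  rel⁻ {x} {y} y< _ | inj₂ _ | inj₂ _ | inj₂ _ | inj₂ e
    with ∨-true⁻ ((0 <ᵇ p) ∧ (x ≡ᵇ 0) ∧ (y ≡ᵇ 3)) e
  ... | inj₁ e₁ = attach 0F refl e₁
  ... | inj₂ e with ∨-true⁻ ((0 <ᵇ q) ∧ (x ≡ᵇ 1) ∧ (y ≡ᵇ (p + 3))) e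
  ...   | inj₁ e₂ = attach 1F (first-position p) e₂
  ...   | inj₂ e₃ = attach 2F (first-position (p + q)) e₃

  arc⁺ : ∀ {x y} → PosArc x y → triRel p q r x y ≡ true
  arc⁺ (0F , zero , 0< , refl , refl) = ∨-trueˡ (∧-true⁺ (<ᵇ-true⁺ 0<) refl)
  arc⁺ (1F , zero , 0< , refl , refl) =
    ∨-trueʳ ((0 <ᵇ p) ∧ false)
      (∨-trueˡ (∧-true⁺ (<ᵇ-true⁺ 0<) (≡ᵇ-true⁺ {3 + (p + 0)} (sym (first-position p)))))
  arc⁺ (2F , zero , 0< , refl , refl) =
    ∨-trueʳ ((p + q + 0 ≡ᵇ 0) ∧ false) (∨-trueʳ ((0 <ᵇ p) ∧ false) (∨-trueʳ ((0 <ᵇ q) ∧ false)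
      (∧-true⁺ (<ᵇ-true⁺ 0<) (≡ᵇ-true⁺ {3 + (p + q + 0)} (sym (first-position (p + q)))))))
  arc⁺ (i , suc k , k< , refl , refl) = let ≢p , ≢p+q = inner-arc i k< in
    ∨-trueˡ (∧-true⁺ (≡ᵇ-true⁺ (+-suc (offset i) k)) (∧-true⁺
      (≢ᵇ-true⁺ λ eq → ≢p (+-cancelˡ-≡ 2 _ _ (trans eq (+-comm p 2))))
      (≢ᵇ-true⁺ λ eq → ≢p+q (+-cancelˡ-≡ 2 _ _ (trans eq (+-comm (p + q) 2))))))

  N≡ : p + q + r + 3 ≡ 3 + (p + q + r)
  N≡ = +-comm (p + q + r) 3

  root⁺ : ∀ (i j : Fin 3) → toℕ i ≢ toℕ j →
    triRel p q r (toℕ i) (toℕ j) ∨ triRel p q r (toℕ j) (toℕ i) ≡ true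
  root⁺ 0F 0F i≢j = contradiction refl i≢j
  root⁺ 1F 1F i≢j = contradiction refl i≢j
  root⁺ 2F 2F i≢j = contradiction refl i≢j
  root⁺ 0F 1F _ = refl
  root⁺ 0F 2F _ = refl
  root⁺ 1F 2F _ = refl
  root⁺ 1F 0F _ = ∨-trueʳ (triRel p q r 1 0) refl
  root⁺ 2F 0F _ = ∨-trueʳ (triRel p q r 2 0) refl
  root⁺ 2F 1F _ = ∨-trueʳ (triRel p q r 2 1) refl

  tri-tripod : Tripod (TriGraph p q r)
  tri-tripod = tripod N≡ (triRel p q r) rel⁻ arc⁺ root⁺

  tri-roots : DistinctRoots tri-tripod
  tri-roots {i} {j} eq = toℕ-injective (root-≡ N≡ (triRel p q r) rel⁻ arc⁺ root⁺ {i} {j} eq)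

-- The two directions of the classification

ends-injective : ∀ {n} {G : Graph n} (P : Tripod G) →
  (∀ {i j} → Tripod.len P i ≡ 0 → Tripod.len P j ≡ 0 → Tripod.at P i 0 ≡ Tripod.at P j 0 → i ≡ j) →
  Injective _≡_ _≡_ (Tripod.end P)
ends-injective P at-root {i} {j} eq with Tripod.injective P ≤-refl ≤-refl eq
... | _ , inj₁ i≡j = i≡j
-- Ends shared by different legs are roots, so both legs are empty.
... | li≡lj , inj₂ li≡0 = at-root li≡0 lj≡0
      (subst₂ (λ k l → at i k ≡ at j l) li≡0 lj≡0 eq)
  where
  open Tripod P
  lj≡0 : len j ≡ 0
  lj≡0 = trans (sym li≡lj) li≡0

IsSpider IsTriangle : ∀ {n} → Graph n → Set
IsSpider {n} G = Σ ℕ λ a → Σ ℕ λ b → Σ ℕ λ c →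
  a ≤ b × b ≤ c × 1 ≤ b × a + b + c ≡ n ∸ 1 × G ≅ Spider a b c
IsTriangle {n} G = Σ ℕ λ p → Σ ℕ λ q → Σ ℕ λ r →
  p ≤ q × q ≤ r × p + q + r ≡ n ∸ 3 × G ≅ TriGraph p q r

module _ {n} {G : Graph n} where

  tripod⇒spider : (P : Tripod G) → SameRoots P → Injective _≡_ _≡_ (Tripod.end P) → IsSpider G
  tripod⇒spider P same end-inj with sorting (Tripod.len P)
  ... | σ , a≤b , b≤c = len 0F , len 1F , len 2F , a≤b , b≤c , nonempty ,
        -- A bijection of finite types forces equal sizes, so the isomorphism also supplies the
        -- equation for the order.
        sym (trans (cong (_∸ 1) (↔⇒≡ (proj₁ iso))) (m+n∸n≡m (len 0F + len 1F + len 2F) 1)) , iso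
    where
    open Tripod (permute σ P)
    open SpiderLayout (len 0F) (len 1F) (len 2F) using (spider-tripod; spider-roots)
    end-injective : Injective _≡_ _≡_ end
    end-injective eq = to-injective σ (end-inj eq)
    ends-meet : len 1F ≡ 0 → end 0F ≡ end 1F
    ends-meet l₁≡0 = trans (cong (at 0F) (n≤0⇒n≡0 (subst (len 0F ≤_) l₁≡0 a≤b)))
      (trans (same _ _) (cong (at 1F) (sym l₁≡0)))
    -- An empty middle leg makes the shortest leg empty too, and both would end in the common root.
    nonempty : 1 ≤ len 1F
    nonempty = n≢0⇒n>0 λ l₁≡0 → case end-injective {0F} {1F} (ends-meet l₁≡0) of λ ()
    iso : G ≅ Spider (len 0F) (len 1F) (len 2F)
    iso = tripod-≅ (permute σ P) spider-tripod (λ { 0F → refl ; 1F → refl ; 2F → refl })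
      (λ i j _ → spider-roots i j) (λ i j _ → same _ _)

  tripod⇒triangle : (P : Tripod G) → DistinctRoots P → IsTriangle G
  tripod⇒triangle P distinct with sorting (Tripod.len P)
  ... | σ , p≤q , q≤r = len 0F , len 1F , len 2F , p≤q , q≤r ,
        sym (trans (cong (_∸ 3) (↔⇒≡ (proj₁ iso))) (m+n∸n≡m (len 0F + len 1F + len 2F) 3)) , iso
    where
    open Tripod (permute σ P)
    open TriLayout (len 0F) (len 1F) (len 2F) using (tri-tripod; tri-roots)
    iso : G ≅ TriGraph (len 0F) (len 1F) (len 2F)
    iso = tripod-≅ (permute σ P) tri-tripod (λ { 0F → refl ; 1F → refl ; 2F → refl })
      (λ i j eq → cong (λ h → Tripod.at tri-tripod h 0) (to-injective σ (distinct eq)))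
      (λ i j eq → cong (λ h → at h 0) (tri-roots {i} {j} eq))

  sdiam⇒classified : Connected G → SDiam 3 G (n ∸ 1) → IsSpider G ⊎ IsTriangle G
  sdiam⇒classified conn ((S , size , _ , large) , _) with enumerate S
  -- The rewrite turns the index type of the terminals into `Fin 3`.
  ... | s , s-inj , S⊆s rewrite size
    with separated⇒tripod G (large-steiner⇒separating G S s S⊆s large) (legs G conn s) s-inj
  ...   | inj₁ (P , same , end-inj) = inj₁ (tripod⇒spider P same end-inj)
  ...   | inj₂ (P , distinct)       = inj₂ (tripod⇒triangle P distinct)

  spider⇒sdiam : Connected G → IsSpider G → SDiam 3 G (n ∸ 1)
  spider⇒sdiam conn (a , b , c , _ , b≤c , 1≤b , _ , G≅) =
    -- Since `1 ≤ b` and `b ≤ c`, only the first leg can be empty, so no two empty legs share the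
    -- centre.
    tripod⇒sdiam P conn (ends-injective P λ i≡0 j≡0 _ → trans (only-first i≡0) (sym (only-first j≡0)))
    where
    open SpiderLayout a b c using (size; spider-tripod)
    P = pullback G≅ spider-tripod
    only-first : ∀ {i} → size i ≡ 0 → i ≡ 0F
    only-first {0F} _    = refl
    only-first {1F} refl = contradiction 1≤b λ ()
    only-first {2F} refl = contradiction (≤-trans 1≤b b≤c) λ ()

  triangle⇒sdiam : Connected G → IsTriangle G → SDiam 3 G (n ∸ 1)
  triangle⇒sdiam conn (p , q , r , _ , _ , _ , G≅@(f , _)) =
    tripod⇒sdiam P conn (ends-injective P λ _ _ eq → tri-roots (from-injective f eq))
    where
    open TriLayout p q r using (tri-tripod; tri-roots)
    P = pullback G≅ tri-tripod

theorem4 : (n : ℕ) → 3 ≤ n → (G : Graph n) → Connected G →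
    (SDiam 3 G (n ∸ 1) ⇔
    ((Σ ℕ λ a → Σ ℕ λ b → Σ ℕ λ c →
    a ≤ b × b ≤ c × 1 ≤ b × a + b + c ≡ n ∸ 1 × G ≅ Spider a b c)
    ⊎
    (Σ ℕ λ p → Σ ℕ λ q → Σ ℕ λ r →
    p ≤ q × q ≤ r × p + q + r ≡ n ∸ 3 × G ≅ TriGraph p q r)))
theorem4 n _ G conn = mk⇔ (sdiam⇒classified conn) (either (spider⇒sdiam conn) (triangle⇒sdiam conn))
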